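{- Let $q$ be a prime power, $e\ge 2$, $r$ a positive integer, $a\in\mathbb{F}_{q^e}$ with $a\neq 0$, $f(x)=x^r(x^{q-1}+a)\in\mathbb{F}_{q^e}[x]$, and $\ell=q^{e-1}+\cdots+q+1$. Then $f(x)$ permutes $\mathbb{F}_{q^e}$ and is the composition of a linearized binomial and a monomial if and only if $(-a)^{\ell}\neq 1$ and $r\equiv s\ell+\sum_{i=0}^{k-1}q^{hi}\pmod{q^e-1}$, where $h$ is a positive integer with $\gcd(h,e)=1$, $k$ is a positive integer whose reduction modulo $e$ is the inverse of $h$ modulo $e$, $s$ is a positive integer, and $\gcd(r,q-1)=1$.
   Context: A polynomial permutes $\mathbb{F}_{q^e}$ if it induces a bijection of $\mathbb{F}_{q^e}$. "$f$ is the composition of a linearized binomial and a monomial" means $f(x)\equiv L(x^n)\pmod{x^{q^e}-x}$ for some monomial $x^n$ and some linearized binomial $L(x)=bx^{q^m}+cx^{q^{m'}}$ with coefficients in $\mathbb{F}_{q^e}$. -}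

module Defs where

open import Algebra.Apartness.Bundles using (HeytingCommutativeRing; HeytingField)
open import Algebra.Bundles using (CommutativeRing; Semiring)
open import Algebra.Bundles.Raw using (RawRing)
import Algebra.Definitions.RawSemiring as RawSemiringDefs
open import Data.Fin.Base using (Fin)
open import Data.List.Base using (List; []; _∷_; map; foldr)
open import Data.Nat.Base using (ℕ; zero; suc; _≤_; _^_; ∣_-_∣)
open import Data.Nat.Divisibility using (_∣_)
open import Data.Nat.Primality using (Prime)
open import Data.Product.Base using (_×_; ∃-syntax)
open import Function.Bundles using (Inverse)
open import Function.Definitions using (Bijective)
open import Level using (_⊔_)
open import Relation.Binary.Bundles using (Setoid)
open import Relation.Binary.PropositionalEquality using (_≡_; _≢_; setoid)

PrimePower : ℕ → Set
PrimePower q = ∃[ p ] ∃[ t ] Prime p × 1 ≤ t × q ≡ p ^ t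

-- ∣ a - b ∣ is the absolute difference, so truncated subtraction plays no role.
infix 4 _≅_[mod_]
_≅_[mod_] : ℕ → ℕ → ℕ → Set
a ≅ b [mod n ] = n ∣ ∣ a - b ∣

HasCardinality : ∀ {c ℓ} → Setoid c ℓ → ℕ → Set (c ⊔ ℓ)
HasCardinality S n = Inverse S (setoid (Fin n))

-- For a field with decidable equality, such as a finite one, the apartness
-- relation of a HeytingField is necessarily the negation of equality.
fieldRing : ∀ {c ℓ₁ ℓ₂} → HeytingField c ℓ₁ ℓ₂ → CommutativeRing c ℓ₁
fieldRing F = HeytingCommutativeRing.commutativeRing
  (HeytingField.heytingCommutativeRing F)

module Polynomials {c ℓ} (R : CommutativeRing c ℓ) where

  open CommutativeRing R
  open RawSemiringDefs (Semiring.rawSemiring semiring) public using () renaming (_^_ to _^ᴿ_)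

  -- Coefficient lists, constant term first.  Trailing zeros are allowed, so
  -- polynomials are compared with _≈ₚ_ and never with _≡_.
  Poly : Set c
  Poly = List Carrier

  coeff : Poly → ℕ → Carrier
  coeff []      _       = 0#
  coeff (a ∷ _) zero    = a
  coeff (_ ∷ p) (suc n) = coeff p n

  infix 4 _≈ₚ_
  _≈ₚ_ : Poly → Poly → Set ℓ
  p ≈ₚ p′ = ∀ n → coeff p n ≈ coeff p′ n

  C : Carrier → Poly
  C a = a ∷ []

  X : Poly
  X = 0# ∷ 1# ∷ []

  infixl 6 _+ₚ_ _-ₚ_
  infixl 7 _*ₚ_

  _+ₚ_ : Poly → Poly → Poly
  []      +ₚ p′       = p′
  (a ∷ p) +ₚ []       = a ∷ p
  (a ∷ p) +ₚ (b ∷ p′) = (a + b) ∷ (p +ₚ p′)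

  -ₚ_ : Poly → Poly
  -ₚ_ = map (-_)

  _-ₚ_ : Poly → Poly → Poly
  p -ₚ p′ = p +ₚ (-ₚ p′)

  _*ₚ_ : Poly → Poly → Poly
  []      *ₚ p′ = []
  (a ∷ p) *ₚ p′ = map (a *_) p′ +ₚ (0# ∷ (p *ₚ p′))

  polyRawRing : RawRing c ℓ
  polyRawRing = record
    { Carrier = Poly
    ; _≈_     = _≈ₚ_
    ; _+_     = _+ₚ_
    ; _*_     = _*ₚ_
    ; -_      = -ₚ_
    ; 0#      = []
    ; 1#      = C 1#
    }

  open RawSemiringDefs (RawRing.rawSemiring polyRawRing) public
    using () renaming (_^_ to _^ₚ_; _∣_ to _∣ₚ_)

  eval : Poly → Carrier → Carrier
  eval p x = foldr (λ a v → a + x * v) 0# p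

  infixr 9 _∘ₚ_
  _∘ₚ_ : Poly → Poly → Poly
  p ∘ₚ g = foldr (λ a v → C a +ₚ g *ₚ v) [] p

  infix 4 _≅ₚ_[mod_]
  _≅ₚ_[mod_] : Poly → Poly → Poly → Set (c ⊔ ℓ)
  p ≅ₚ p′ [mod m ] = m ∣ₚ (p -ₚ p′)

  Permutes : Poly → Set (c ⊔ ℓ)
  Permutes p = Bijective _≈_ _≈_ (eval p)

  -- A binomial has exactly two terms: nonzero coefficients, distinct degrees.
  LinearizedBinomial : ℕ → Poly → Set (c ⊔ ℓ)
  LinearizedBinomial q L =
    ∃[ m ] ∃[ m′ ] ∃[ b ] ∃[ d ]
      m ≢ m′ × b ≉ 0# × d ≉ 0# ×
      L ≈ₚ C b *ₚ X ^ₚ (q ^ m) +ₚ C d *ₚ X ^ₚ (q ^ m′)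

  -- Here the coefficient ring is meant to have q ^ e elements.
  LinearizedBinomial∘Monomial : ℕ → ℕ → Poly → Set (c ⊔ ℓ)
  LinearizedBinomial∘Monomial q e f =
    ∃[ L ] ∃[ n ]
      LinearizedBinomial q L ×
      f ≅ₚ L ∘ₚ (X ^ₚ n) [mod X ^ₚ (q ^ e) -ₚ X ]

{-# OPTIONS --safe #-}
-- Write N = q^e - 1 = (q - 1)ℓ.  As functions, f is x^(r+q-1) + a x^r, and a polynomial of degree < N
-- vanishing on all nonzero elements is zero.  Comparing exponents mod N in f = L(x^n) therefore gives
-- r q^h ≡ r + q - 1 (mod N) for some h ≥ 1, and conversely this congruence says that f(x) = L(x^r) with
-- L(u) = u^(q^h) + a u.  With S = ∑_{i<k} q^(hi), since S · (q^h - 1) = q^(hk) - 1, the congruence is equivalent to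
-- gcd(h, e) = 1 and r ≡ sℓ + S (mod N), where hk ≡ 1 (mod e).
-- The map x ↦ x^r is injective when moreover gcd(r, q-1) = 1, since the congruence makes x^r determine
-- x^(q-1); the additive map L is injective when (-a)^ℓ ≠ 1, since a nonzero u with u^(q^h - 1) = -a would
-- give (-a)^ℓ = 1.
module Submission where

open import Defs
open import Algebra.Apartness.Bundles using (HeytingField)
open import Algebra.Bundles using (CommutativeRing)
import Algebra.Properties.CommutativeMonoid.Sum as Sum
open import Data.Fin.Base using (Fin; zero; suc; punchIn; punchOut; toℕ; fromℕ; inject₁)
open import Data.Fin.Permutation using (Permutation; permutation)
import Data.Fin.Properties as Fin
open import Data.List.Base using ([]; _∷_; map; length; applyUpTo)
open import Data.Nat.Base using (ℕ; zero; suc; pred; _≤_; _<_; _∸_; _^_; z≤n; s≤s; s≤s⁻¹; ∣_-_∣; _⊔_; _!; NonZero; >-nonZero; >-nonZero⁻¹; ≢-nonZero⁻¹; nonTrivial⇒n>1) renaming (_+_ to _+ℕ_; _*_ to _*ℕ_)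
open import Data.Nat.Combinatorics using (nCk≡n!/k![n-k]!; nCk≡nC[n∸k]; nCn≡1; k![n∸k]!∣n!) renaming (_C_ to _choose_)
open import Data.Nat.Coprimality using (coprime-Bézout; gcd≡1⇒coprime)
open import Data.Nat.Divisibility as ∣ using (_∣_; divides)
open import Data.Nat.DivMod using (_%_; _/_; m≡m%n+[m/n]*n; m%n<n; m%n%n≡m%n; m/n*n≡m)
open import Data.Nat.GCD using (gcd; gcd[m,n]∣m; gcd[m,n]∣n; module Bézout)
open import Data.Nat.ListAction using (sum)
open import Data.Nat.Primality using (Prime; euclidsLemma; prime⇒nonZero; prime⇒nonTrivial; ¬prime[1])
import Data.Nat.Properties as ℕ
open import Data.Nat.Tactic.RingSolver using (solve-∀)
open import Data.Product.Base using (_×_; _,_; ∃-syntax; proj₁; proj₂)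
open import Data.Sum.Base using (_⊎_; inj₁; inj₂)
open import Function.Base using (_∘_)
open import Function.Bundles using (_⇔_; mk⇔; Inverse)
open import Function.Definitions using (Injective; Bijective; Congruent)
open import Relation.Binary.Bundles using (Setoid)
open import Relation.Binary.PropositionalEquality using (_≡_; _≢_; cong; cong₂; subst; subst₂; module ≡-Reasoning)
import Relation.Binary.PropositionalEquality as ≡
import Relation.Binary.Reasoning.Setoid as SetoidReasoning
open import Relation.Nullary using (Dec; yes; no; contradiction; ¬_)
open import Relation.Nullary.Decidable using (map′)

-- The congruence r q^h ≡ r + q - 1 is affine in r. S is a particular solution, and multiples of ℓ
-- solve the homogeneous equation, because q^h ≡ 1 modulo q - 1. Conversely the congruence
-- determines r modulo ℓ and no further, which is why the free parameter `s` appears in the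
-- criterion. That f is L(x^n) means divisibility by X^(q^e) - X, not equality of functions, so the
-- converse has to exhibit a quotient. It exists because the two exponents exchanged are positive:
-- X^N and 1 differ at 0. For the same reason exponents are reduced modulo N only at nonzero
-- elements, and 0 is treated apart. The conditions (-a)^ℓ ≠ 1 and gcd(r, q-1) = 1 are forced by the
-- injectivity of f through the same root bound: if one of them failed, some nonzero polynomial of
-- degree below N would vanish on all nonzero elements. Through ℓ > 1, the hypothesis e ≥ 2 keeps r
-- + q - 1 and r distinct modulo N, without which exponents could not be compared.

-- Congruences of natural numbers

-- Congruence with explicit multipliers on both sides, so that no subtraction occurs.
infix 4 _∼_[_]
record _∼_[_] (a b n : ℕ) : Set where
  constructor congruent
  field
    u v : ℕ
    eq  : a +ℕ u *ℕ n ≡ b +ℕ v *ℕ n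

module _ {n : ℕ} where

  ∼-reflexive : ∀ {a b} → a ≡ b → a ∼ b [ n ]
  ∼-reflexive a≡b = congruent 0 0 (cong (_+ℕ 0) a≡b)

  ∼-refl : ∀ {a} → a ∼ a [ n ]
  ∼-refl = ∼-reflexive ≡.refl

  ∼-sym : ∀ {a b} → a ∼ b [ n ] → b ∼ a [ n ]
  ∼-sym (congruent u v eq) = congruent v u (≡.sym eq)

  ∼-trans : ∀ {a b d} → a ∼ b [ n ] → b ∼ d [ n ] → a ∼ d [ n ]
  ∼-trans {a} {b} {d} (congruent u v eq) (congruent u′ v′ eq′) =
    congruent (u +ℕ u′) (v +ℕ v′) (begin
      a +ℕ (u +ℕ u′) *ℕ n       ≡⟨ split a u u′ n ⟩
      (a +ℕ u *ℕ n) +ℕ u′ *ℕ n  ≡⟨ cong (_+ℕ u′ *ℕ n) eq ⟩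
      (b +ℕ v *ℕ n) +ℕ u′ *ℕ n  ≡⟨ swap b (v *ℕ n) (u′ *ℕ n) ⟩
      (b +ℕ u′ *ℕ n) +ℕ v *ℕ n  ≡⟨ cong (_+ℕ v *ℕ n) eq′ ⟩
      (d +ℕ v′ *ℕ n) +ℕ v *ℕ n  ≡⟨ split′ d v v′ n ⟩
      d +ℕ (v +ℕ v′) *ℕ n       ∎)
    where
    open ≡-Reasoning
    split : ∀ a u u′ n → a +ℕ (u +ℕ u′) *ℕ n ≡ (a +ℕ u *ℕ n) +ℕ u′ *ℕ n
    split = solve-∀
    swap : ∀ a x y → (a +ℕ x) +ℕ y ≡ (a +ℕ y) +ℕ x
    swap = solve-∀
    split′ : ∀ d v v′ n → (d +ℕ v′ *ℕ n) +ℕ v *ℕ n ≡ d +ℕ (v +ℕ v′) *ℕ n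
    split′ = solve-∀

  ∼-+-cong : ∀ {a b a′ b′} → a ∼ b [ n ] → a′ ∼ b′ [ n ] → a +ℕ a′ ∼ b +ℕ b′ [ n ]
  ∼-+-cong {a} {b} {a′} {b′} (congruent u v eq) (congruent u′ v′ eq′) =
    congruent (u +ℕ u′) (v +ℕ v′) (begin
      a +ℕ a′ +ℕ (u +ℕ u′) *ℕ n         ≡⟨ regroup a a′ u u′ n ⟩
      (a +ℕ u *ℕ n) +ℕ (a′ +ℕ u′ *ℕ n)  ≡⟨ cong₂ _+ℕ_ eq eq′ ⟩
      (b +ℕ v *ℕ n) +ℕ (b′ +ℕ v′ *ℕ n)  ≡⟨ regroup b b′ v v′ n ⟨
      b +ℕ b′ +ℕ (v +ℕ v′) *ℕ n         ∎)
    where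
    open ≡-Reasoning
    regroup : ∀ a a′ u u′ n → a +ℕ a′ +ℕ (u +ℕ u′) *ℕ n ≡ (a +ℕ u *ℕ n) +ℕ (a′ +ℕ u′ *ℕ n)
    regroup = solve-∀

  ∼-*-congˡ : ∀ d {a b} → a ∼ b [ n ] → d *ℕ a ∼ d *ℕ b [ n ]
  ∼-*-congˡ d {a} {b} (congruent u v eq) = congruent (d *ℕ u) (d *ℕ v) (begin
      d *ℕ a +ℕ d *ℕ u *ℕ n  ≡⟨ factor d a u n ⟩
      d *ℕ (a +ℕ u *ℕ n)     ≡⟨ cong (d *ℕ_) eq ⟩
      d *ℕ (b +ℕ v *ℕ n)     ≡⟨ factor d b v n ⟨
      d *ℕ b +ℕ d *ℕ v *ℕ n  ∎)
    where
    open ≡-Reasoning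
    factor : ∀ d a u n → d *ℕ a +ℕ d *ℕ u *ℕ n ≡ d *ℕ (a +ℕ u *ℕ n)
    factor = solve-∀

  ∼-*-congʳ : ∀ d {a b} → a ∼ b [ n ] → a *ℕ d ∼ b *ℕ d [ n ]
  ∼-*-congʳ d {a} {b} a∼b rewrite ℕ.*-comm a d | ℕ.*-comm b d = ∼-*-congˡ d a∼b

  ∼-^-cong : ∀ k {a b} → a ∼ b [ n ] → a ^ k ∼ b ^ k [ n ]
  ∼-^-cong zero    a∼b = ∼-refl
  ∼-^-cong (suc k) {a} {b} a∼b = ∼-trans (∼-*-congʳ (a ^ k) a∼b) (∼-*-congˡ b (∼-^-cong k a∼b))

  ∼-^-1 : ∀ k {a} → a ∼ 1 [ n ] → a ^ k ∼ 1 [ n ]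
  ∼-^-1 k a∼1 = ∼-trans (∼-^-cong k a∼1) (∼-reflexive (ℕ.^-zeroˡ k))

  -- Takes the place of subtraction: a relation between differences is stated with a common summand
  -- on both sides, which is removed here.
  ∼-+-cancelˡ : ∀ d {a b} → d +ℕ a ∼ d +ℕ b [ n ] → a ∼ b [ n ]
  ∼-+-cancelˡ d {a} {b} (congruent u v eq) = congruent u v (ℕ.+-cancelˡ-≡ d _ _ (begin
      d +ℕ (a +ℕ u *ℕ n)  ≡⟨ ℕ.+-assoc d a _ ⟨
      d +ℕ a +ℕ u *ℕ n    ≡⟨ eq ⟩
      d +ℕ b +ℕ v *ℕ n    ≡⟨ ℕ.+-assoc d b _ ⟩
      d +ℕ (b +ℕ v *ℕ n)  ∎))
    where open ≡-Reasoning

  ∼-setoid : Setoid _ _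
  ∼-setoid = record
    { _≈_           = _∼_[ n ]
    ; isEquivalence = record { refl = ∼-refl ; sym = ∼-sym ; trans = ∼-trans }
    }

  ∼⇒≅ : ∀ {a b} → a ∼ b [ n ] → a ≅ b [mod n ]
  ∼⇒≅ {a} {b} (congruent u v eq) with ℕ.≤-total a b
  ... | inj₁ a≤b = subst (n ∣_) (≡.sym (ℕ.m≤n⇒∣m-n∣≡n∸m a≤b))
          (∣.∣m+n∣m⇒∣n (subst (n ∣_) eq′ (∣.n∣m*n u)) (∣.n∣m*n v))
    where
    eq′ : u *ℕ n ≡ v *ℕ n +ℕ (b ∸ a)
    eq′ = ℕ.+-cancelˡ-≡ a _ _ (begin
      a +ℕ u *ℕ n                 ≡⟨ eq ⟩
      b +ℕ v *ℕ n                 ≡⟨ cong (_+ℕ v *ℕ n) (ℕ.m+[n∸m]≡n a≤b) ⟨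
      a +ℕ (b ∸ a) +ℕ v *ℕ n      ≡⟨ ℕ.+-assoc a _ _ ⟩
      a +ℕ ((b ∸ a) +ℕ v *ℕ n)    ≡⟨ cong (a +ℕ_) (ℕ.+-comm (b ∸ a) _) ⟩
      a +ℕ (v *ℕ n +ℕ (b ∸ a))    ∎)
      where open ≡-Reasoning
  ... | inj₂ b≤a = subst (n ∣_) (≡.sym (ℕ.m≤n⇒∣n-m∣≡n∸m b≤a))
          (∣.∣m+n∣m⇒∣n (subst (n ∣_) eq′ (∣.n∣m*n v)) (∣.n∣m*n u))
    where
    eq′ : v *ℕ n ≡ u *ℕ n +ℕ (a ∸ b)
    eq′ = ℕ.+-cancelˡ-≡ b _ _ (begin
      b +ℕ v *ℕ n                 ≡⟨ eq ⟨
      a +ℕ u *ℕ n                 ≡⟨ cong (_+ℕ u *ℕ n) (ℕ.m+[n∸m]≡n b≤a) ⟨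
      b +ℕ (a ∸ b) +ℕ u *ℕ n      ≡⟨ ℕ.+-assoc b _ _ ⟩
      b +ℕ ((a ∸ b) +ℕ u *ℕ n)    ≡⟨ cong (b +ℕ_) (ℕ.+-comm (a ∸ b) _) ⟩
      b +ℕ (u *ℕ n +ℕ (a ∸ b))    ∎)
      where open ≡-Reasoning

  ≅⇒∼ : ∀ {a b} → a ≅ b [mod n ] → a ∼ b [ n ]
  ≅⇒∼ {a} {b} (divides w eq) with ℕ.≤-total a b
  ... | inj₁ a≤b = congruent w 0 (begin
      a +ℕ w *ℕ n      ≡⟨ cong (a +ℕ_) eq ⟨
      a +ℕ ∣ a - b ∣   ≡⟨ cong (a +ℕ_) (ℕ.m≤n⇒∣m-n∣≡n∸m a≤b) ⟩
      a +ℕ (b ∸ a)     ≡⟨ ℕ.m+[n∸m]≡n a≤b ⟩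
      b                ≡⟨ ℕ.+-identityʳ b ⟨
      b +ℕ 0           ∎)
    where open ≡-Reasoning
  ... | inj₂ b≤a = congruent 0 w (begin
      a +ℕ 0           ≡⟨ ℕ.+-identityʳ a ⟩
      a                ≡⟨ ℕ.m+[n∸m]≡n b≤a ⟨
      b +ℕ (a ∸ b)     ≡⟨ cong (b +ℕ_) (ℕ.m≤n⇒∣n-m∣≡n∸m b≤a) ⟨
      b +ℕ ∣ a - b ∣   ≡⟨ cong (b +ℕ_) eq ⟩
      b +ℕ w *ℕ n      ∎)
    where open ≡-Reasoning

  ∼0⇒∣ : ∀ {a} → a ∼ 0 [ n ] → n ∣ a
  ∼0⇒∣ {a} a∼0 = subst (n ∣_) (ℕ.∣-∣-identityʳ a) (∼⇒≅ a∼0)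
    
∣⇒∼ : ∀ {n d a b} → d ∣ n → a ∼ b [ n ] → a ∼ b [ d ]
∣⇒∼ {d = d} {a} {b} (divides w ≡.refl) (congruent u v eq) = congruent (u *ℕ w) (v *ℕ w) (begin
    a +ℕ u *ℕ w *ℕ d    ≡⟨ cong (a +ℕ_) (ℕ.*-assoc u w d) ⟩
    a +ℕ u *ℕ (w *ℕ d)  ≡⟨ eq ⟩
    b +ℕ v *ℕ (w *ℕ d)  ≡⟨ cong (b +ℕ_) (ℕ.*-assoc v w d) ⟨
    b +ℕ v *ℕ w *ℕ d    ∎)
  where open ≡-Reasoning

∼-scale : ∀ d {n a b} → a ∼ b [ n ] → d *ℕ a ∼ d *ℕ b [ d *ℕ n ]
∼-scale d {n} {a} {b} (congruent u v eq) = congruent u v (begin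
    d *ℕ a +ℕ u *ℕ (d *ℕ n)  ≡⟨ factor d a u n ⟩
    d *ℕ (a +ℕ u *ℕ n)       ≡⟨ cong (d *ℕ_) eq ⟩
    d *ℕ (b +ℕ v *ℕ n)       ≡⟨ factor d b v n ⟨
    d *ℕ b +ℕ v *ℕ (d *ℕ n)  ∎)
  where
  open ≡-Reasoning
  factor : ∀ d a u n → d *ℕ a +ℕ u *ℕ (d *ℕ n) ≡ d *ℕ (a +ℕ u *ℕ n)
  factor = solve-∀

-- The factor leaves the modulus as well; with `d` equal to q - 1 this is the descent from `N` to
-- `ℓ`.
∼-unscale : ∀ d .{{_ : NonZero d}} {n a b} → d *ℕ a ∼ d *ℕ b [ d *ℕ n ] → a ∼ b [ n ]
∼-unscale d {n} {a} {b} (congruent u v eq) = congruent u v (ℕ.*-cancelˡ-≡ _ _ d (begin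
    d *ℕ (a +ℕ u *ℕ n)       ≡⟨ factor d a u n ⟨
    d *ℕ a +ℕ u *ℕ (d *ℕ n)  ≡⟨ eq ⟩
    d *ℕ b +ℕ v *ℕ (d *ℕ n)  ≡⟨ factor d b v n ⟩
    d *ℕ (b +ℕ v *ℕ n)       ∎))
  where
  open ≡-Reasoning
  factor : ∀ d a u n → d *ℕ a +ℕ u *ℕ (d *ℕ n) ≡ d *ℕ (a +ℕ u *ℕ n)
  factor = solve-∀

∼-inverse : ∀ h e → gcd h e ≡ 1 → ∃[ k ] 1 ≤ k × h *ℕ k ∼ 1 [ e ]
∼-inverse h zero gcd≡1 with coprime-Bézout (gcd≡1⇒coprime {h} {0} gcd≡1)
... | Bézout.+- x y eq = x , 1≤x x eq , congruent 0 0 (≡.sym (begin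
    1 +ℕ 0             ≡⟨ cong (1 +ℕ_) (ℕ.*-zeroʳ y) ⟨
    1 +ℕ y *ℕ 0        ≡⟨ eq ⟩
    x *ℕ h             ≡⟨ ℕ.*-comm x h ⟩
    h *ℕ x             ≡⟨ ℕ.+-identityʳ _ ⟨
    h *ℕ x +ℕ 0        ∎))
  where
  open ≡-Reasoning
  1≤x : ∀ x → 1 +ℕ y *ℕ 0 ≡ x *ℕ h → 1 ≤ x
  1≤x zero ()
  1≤x (suc _) _ = s≤s z≤n
... | Bézout.-+ x y eq = contradiction (≡.trans eq (ℕ.*-zeroʳ y)) λ ()
∼-inverse h e@(suc e-1) gcd≡1 with coprime-Bézout (gcd≡1⇒coprime {h} {e} gcd≡1)
-- Here x is already an inverse of h; the added `e` makes positivity immediate and changes nothing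
-- modulo `e`.
... | Bézout.+- x y eq = x +ℕ e , ℕ.≤-trans (s≤s z≤n) (ℕ.m≤n+m e x) , congruent 0 (y +ℕ h) (begin
    h *ℕ (x +ℕ e) +ℕ 0       ≡⟨ expand h x e ⟩
    x *ℕ h +ℕ h *ℕ e         ≡⟨ cong (_+ℕ h *ℕ e) eq ⟨
    1 +ℕ y *ℕ e +ℕ h *ℕ e    ≡⟨ collect y h e ⟩
    1 +ℕ (y +ℕ h) *ℕ e       ∎)
  where
  open ≡-Reasoning
  expand : ∀ h x e → h *ℕ (x +ℕ e) +ℕ 0 ≡ x *ℕ h +ℕ h *ℕ e
  expand = solve-∀
  collect : ∀ y h e → 1 +ℕ y *ℕ e +ℕ h *ℕ e ≡ 1 +ℕ (y +ℕ h) *ℕ e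
  collect = solve-∀
-- Here -x is the inverse of h, and x (e - 1) represents it modulo `e`. That product is 0 when x = 0
-- or e = 1, so `e` is added to keep the witness positive.
... | Bézout.-+ x y eq = x *ℕ e-1 +ℕ e , ℕ.≤-trans (s≤s z≤n) (ℕ.m≤n+m e (x *ℕ e-1)) , congruent 1 (y *ℕ e-1 +ℕ h) (begin
    h *ℕ (x *ℕ e-1 +ℕ e) +ℕ 1 *ℕ e              ≡⟨ expand h x e-1 ⟩
    (1 +ℕ x *ℕ h) *ℕ e-1 +ℕ (1 +ℕ h *ℕ e)       ≡⟨ cong (λ z → z *ℕ e-1 +ℕ (1 +ℕ h *ℕ e)) eq ⟩
    y *ℕ e *ℕ e-1 +ℕ (1 +ℕ h *ℕ e)              ≡⟨ collect y e e-1 h ⟩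
    1 +ℕ (y *ℕ e-1 +ℕ h) *ℕ e                   ∎)
  where
  open ≡-Reasoning
  expand : ∀ h x e-1 → h *ℕ (x *ℕ e-1 +ℕ suc e-1) +ℕ 1 *ℕ suc e-1 ≡ (1 +ℕ x *ℕ h) *ℕ e-1 +ℕ (1 +ℕ h *ℕ suc e-1)
  expand = solve-∀
  collect : ∀ y e e-1 h → y *ℕ e *ℕ e-1 +ℕ (1 +ℕ h *ℕ e) ≡ 1 +ℕ (y *ℕ e-1 +ℕ h) *ℕ e
  collect = solve-∀

-- The exponent congruence modulo q^e - 1

-- The geometric series, with both sides moved so that no subtraction occurs.
geometric : ∀ x (f : ℕ → ℕ) → (∀ i → f (suc i) ≡ x *ℕ f i) →
            ∀ k → sum (applyUpTo f k) *ℕ x +ℕ f 0 ≡ sum (applyUpTo f k) +ℕ f k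
geometric x f step zero    = ≡.refl
geometric x f step (suc k) = begin
    (f 0 +ℕ S) *ℕ x +ℕ f 0          ≡⟨ expand (f 0) S x ⟩
    (S *ℕ x +ℕ x *ℕ f 0) +ℕ f 0     ≡⟨ cong (λ z → S *ℕ x +ℕ z +ℕ f 0) (step 0) ⟨
    (S *ℕ x +ℕ f 1) +ℕ f 0          ≡⟨ cong (_+ℕ f 0) (geometric x (λ i → f (suc i)) (λ i → step (suc i)) k) ⟩
    (S +ℕ f (suc k)) +ℕ f 0         ≡⟨ rotate S (f (suc k)) (f 0) ⟩
    (f 0 +ℕ S) +ℕ f (suc k)         ∎
  where
  open ≡-Reasoning
  S = sum (applyUpTo (λ i → f (suc i)) k)
  expand : ∀ y S x → (y +ℕ S) *ℕ x +ℕ y ≡ (S *ℕ x +ℕ x *ℕ y) +ℕ y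
  expand = solve-∀
  rotate : ∀ S z y → (S +ℕ z) +ℕ y ≡ (y +ℕ S) +ℕ z
  rotate = solve-∀

-- The parameter `c` is q - 1, so that q - 1 and q^e - 1 = `c *ℕ ℓ` are available without truncated
-- subtraction.
module Exponents (c e : ℕ) .{{_ : NonZero c}} where

  q ℓ N : ℕ
  q = suc c
  ℓ = sum (applyUpTo (λ i → q ^ i) e)
  N = c *ℕ ℓ

  q^e≡1+N : q ^ e ≡ suc N
  q^e≡1+N = ℕ.+-cancelˡ-≡ ℓ _ _ (begin
    ℓ +ℕ q ^ e        ≡⟨ geometric q (q ^_) (λ _ → ≡.refl) e ⟨
    ℓ *ℕ suc c +ℕ 1   ≡⟨ rearrange ℓ c ⟩
    ℓ +ℕ suc (c *ℕ ℓ) ∎)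
    where
    open ≡-Reasoning
    rearrange : ∀ l c → l *ℕ suc c +ℕ 1 ≡ l +ℕ suc (c *ℕ l)
    rearrange = solve-∀

  1<ℓ : 2 ≤ e → 1 < ℓ
  1<ℓ (s≤s (s≤s _)) = s≤s (ℕ.≤-trans (s≤s z≤n) (ℕ.m≤m+n (q *ℕ 1) _))

  q^e∸1≡N : q ^ e ∸ 1 ≡ N
  q^e∸1≡N = cong (_∸ 1) q^e≡1+N

  q^e∼1 : q ^ e ∼ 1 [ N ]
  q^e∼1 = congruent 0 1 (begin
    q ^ e +ℕ 0       ≡⟨ ℕ.+-identityʳ _ ⟩
    q ^ e            ≡⟨ q^e≡1+N ⟩
    suc N            ≡⟨ cong suc (ℕ.*-identityˡ N) ⟨
    1 +ℕ 1 *ℕ N      ∎)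
    where open ≡-Reasoning

  -- Multiples of `e` can be added to an exponent of `q` because `q ^ e` is 1 modulo `N`.
  q^-∼ : ∀ {i j} → i ∼ j [ e ] → q ^ i ∼ q ^ j [ N ]
  q^-∼ {i} {j} (congruent u v eq) = begin
    q ^ i                ≈⟨ absorb i u ⟩
    q ^ (i +ℕ u *ℕ e)    ≡⟨ cong (q ^_) eq ⟩
    q ^ (j +ℕ v *ℕ e)    ≈⟨ absorb j v ⟨
    q ^ j                ∎
    where
    open SetoidReasoning (∼-setoid {N})
    absorb : ∀ i u → q ^ i ∼ q ^ (i +ℕ u *ℕ e) [ N ]
    absorb i u = begin
      q ^ i                   ≡⟨ ℕ.*-identityʳ _ ⟨
      q ^ i *ℕ 1              ≈⟨ ∼-*-congˡ (q ^ i) (∼-^-1 u q^e∼1) ⟨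
      q ^ i *ℕ (q ^ e) ^ u    ≡⟨ cong (q ^ i *ℕ_) (ℕ.^-*-assoc q e u) ⟩
      q ^ i *ℕ q ^ (e *ℕ u)   ≡⟨ cong (λ z → q ^ i *ℕ q ^ z) (ℕ.*-comm e u) ⟩
      q ^ i *ℕ q ^ (u *ℕ e)   ≡⟨ ℕ.^-distribˡ-+-* q i (u *ℕ e) ⟨
      q ^ (i +ℕ u *ℕ e)       ∎

  -- Eliminates `n`. Since `q` is invertible modulo `N`, the exponent sought is j - i modulo `e`;
  -- the summand `i *ℕ pred e` stands for -i, and the leading `e` makes the result positive.
  shift-exponent : .{{_ : NonZero e}} → ∀ r n i j → r ∼ n *ℕ q ^ i [ N ] → r +ℕ c ∼ n *ℕ q ^ j [ N ] →
                   r *ℕ q ^ (e +ℕ j +ℕ i *ℕ pred e) ∼ r +ℕ c [ N ]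
  shift-exponent r n i j r∼ r+c∼ = begin
      r *ℕ q ^ h                 ≈⟨ ∼-*-congʳ (q ^ h) r∼ ⟩
      n *ℕ q ^ i *ℕ q ^ h        ≡⟨ ℕ.*-assoc n (q ^ i) (q ^ h) ⟩
      n *ℕ (q ^ i *ℕ q ^ h)      ≡⟨ cong (n *ℕ_) (ℕ.^-distribˡ-+-* q i h) ⟨
      n *ℕ q ^ (i +ℕ h)          ≈⟨ ∼-*-congˡ n (q^-∼ i+h∼j) ⟩
      n *ℕ q ^ j                 ≈⟨ r+c∼ ⟨
      r +ℕ c                     ∎
    where
    open SetoidReasoning (∼-setoid {N})
    h = e +ℕ j +ℕ i *ℕ pred e
    collect : ∀ i j e-1 → i +ℕ (suc e-1 +ℕ j +ℕ i *ℕ e-1) +ℕ 0 ≡ j +ℕ suc i *ℕ suc e-1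
    collect = solve-∀
    i+h∼j : i +ℕ h ∼ j [ e ]
    i+h∼j = congruent 0 (suc i) (subst (λ e → i +ℕ (e +ℕ j +ℕ i *ℕ pred e) +ℕ 0 ≡ j +ℕ suc i *ℕ e)
      (ℕ.suc-pred e) (collect i j (pred e)))

  σ : ℕ → ℕ → ℕ
  σ h k = sum (applyUpTo (λ i → q ^ (h *ℕ i)) k)

  module _ (r h : ℕ) where

    -- The series telescopes to `q ^ (h *ℕ k)`, which is `q` modulo `N` because `h *ℕ k` is 1 modulo
    -- `e`. So `σ h k` itself satisfies the congruence that is imposed on `r`.
    σ-telescope : ∀ k → h *ℕ k ∼ 1 [ e ] → σ h k *ℕ q ^ h ∼ σ h k +ℕ c [ N ]
    σ-telescope k hk∼1 = ∼-+-cancelˡ 1 (begin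
      1 +ℕ σ h k *ℕ q ^ h              ≡⟨ ℕ.+-comm 1 _ ⟩
      σ h k *ℕ q ^ h +ℕ 1              ≡⟨ cong (λ z → σ h k *ℕ q ^ h +ℕ q ^ z) (ℕ.*-zeroʳ h) ⟨
      σ h k *ℕ q ^ h +ℕ q ^ (h *ℕ 0)   ≡⟨ geometric (q ^ h) (λ i → q ^ (h *ℕ i)) step k ⟩
      σ h k +ℕ q ^ (h *ℕ k)            ≈⟨ ∼-+-cong ∼-refl (∼-trans (q^-∼ hk∼1) (∼-reflexive (ℕ.*-identityʳ q))) ⟩
      σ h k +ℕ suc c                   ≡⟨ ℕ.+-suc (σ h k) c ⟩
      1 +ℕ (σ h k +ℕ c)                ∎)
      where
      open SetoidReasoning (∼-setoid {N})
      step : ∀ i → q ^ (h *ℕ suc i) ≡ q ^ h *ℕ q ^ (h *ℕ i)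
      step i = ≡.trans (cong (q ^_) (ℕ.*-suc h i)) (ℕ.^-distribˡ-+-* q h (h *ℕ i))

    -- For a common divisor g of `h` and `e`, q^g - 1 divides both q^h - 1 and `N`. Modulo q^g - 1
    -- the relation therefore reads r ≡ r + (q - 1), so q^g - 1 divides q - 1, and size leaves only
    -- g = 1.
    exponent⇒coprime : 2 ≤ e → r *ℕ q ^ h ∼ r +ℕ c [ N ] → gcd h e ≡ 1
    exponent⇒coprime 2≤e rel = g≡1 (gcd h e) (gcd[m,n]∣m h e) (gcd[m,n]∣n h e)
      where
      q^g≡ : ∀ g → q ^ g ≡ suc (q ^ g ∸ 1)
      q^g≡ g = ≡.sym (ℕ.m+[n∸m]≡n (ℕ.m^n>0 q g))
      q^g∼1 : ∀ g → q ^ g ∼ 1 [ q ^ g ∸ 1 ]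
      q^g∼1 g = congruent 0 1 (≡.trans (ℕ.+-identityʳ _)
        (≡.trans (q^g≡ g) (cong suc (≡.sym (ℕ.*-identityˡ _)))))
      multiple : ∀ {g j} → g ∣ j → q ^ j ∼ 1 [ q ^ g ∸ 1 ]
      multiple {g} (divides w ≡.refl) = ∼-trans
        (∼-reflexive (≡.trans (cong (q ^_) (ℕ.*-comm w g)) (≡.sym (ℕ.^-*-assoc q g w))))
        (∼-^-1 w (q^g∼1 g))
      q^g-1∣N : ∀ {g} → g ∣ e → q ^ g ∸ 1 ∣ N
      q^g-1∣N g∣e = ∼0⇒∣ (∼-+-cancelˡ 1 (∼-trans (∼-reflexive (≡.sym q^e≡1+N)) (multiple g∣e)))
      q^g-1∣c : ∀ {g} → g ∣ h → g ∣ e → q ^ g ∸ 1 ∣ c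
      q^g-1∣c {g} g∣h g∣e = ∼0⇒∣ (∼-+-cancelˡ r (begin
        r +ℕ c       ≈⟨ ∣⇒∼ (q^g-1∣N g∣e) rel ⟨
        r *ℕ q ^ h   ≈⟨ ∼-*-congˡ r (multiple g∣h) ⟩
        r *ℕ 1       ≡⟨ ℕ.*-identityʳ r ⟩
        r            ≡⟨ ℕ.+-identityʳ r ⟨
        r +ℕ 0       ∎))
        where open SetoidReasoning (∼-setoid {q ^ g ∸ 1})
      g≡1 : ∀ g → g ∣ h → g ∣ e → g ≡ 1
      g≡1 zero g∣h g∣e = contradiction (∣.0∣⇒≡0 g∣e) λ { ≡.refl → contradiction 2≤e λ () }
      g≡1 (suc zero) g∣h g∣e = ≡.refl
      g≡1 g@(suc (suc g-2)) g∣h g∣e = contradiction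
        (subst (_≤ q) (≡.sym (q^g≡ g)) (s≤s (∣.∣⇒≤ (q^g-1∣c g∣h g∣e))))
        (ℕ.<⇒≱ (ℕ.<-≤-trans (ℕ.m<m*n q q (s≤s (>-nonZero⁻¹ c)))
                 (ℕ.*-monoʳ-≤ q (ℕ.m≤m*n q (q ^ g-2) {{ℕ.m^n≢0 q g-2}}))))

    -- Multiplying the relation by `σ h k` and telescoping gives (q - 1) r ≡ (q - 1) `σ h k` modulo
    -- (q - 1) `ℓ`, after `r *ℕ σ h k` is removed from both sides. Division by q - 1 leaves a
    -- congruence modulo `ℓ`.
    exponent⇒geometric : ∀ k → h *ℕ k ∼ 1 [ e ] → r *ℕ q ^ h ∼ r +ℕ c [ N ] →
                         ∃[ s ] 1 ≤ s × r ∼ s *ℕ ℓ +ℕ σ h k [ N ]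
    exponent⇒geometric k hk∼1 rel = lift (∼-unscale c (∼-+-cancelˡ (r *ℕ σ h k) (begin
        r *ℕ σ h k +ℕ c *ℕ r       ≡⟨ factor r (σ h k) c ⟩
        r *ℕ (σ h k +ℕ c)          ≈⟨ ∼-*-congˡ r (σ-telescope k hk∼1) ⟨
        r *ℕ (σ h k *ℕ q ^ h)      ≡⟨ swap r (σ h k) (q ^ h) ⟩
        (r *ℕ q ^ h) *ℕ σ h k      ≈⟨ ∼-*-congʳ (σ h k) rel ⟩
        (r +ℕ c) *ℕ σ h k          ≡⟨ ℕ.*-distribʳ-+ (σ h k) r c ⟩
        r *ℕ σ h k +ℕ c *ℕ σ h k     ∎)))
      where
      open SetoidReasoning (∼-setoid {N})
      factor : ∀ r S c → r *ℕ S +ℕ c *ℕ r ≡ r *ℕ (S +ℕ c)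
      factor = solve-∀
      swap : ∀ r S x → r *ℕ (S *ℕ x) ≡ (r *ℕ x) *ℕ S
      swap = solve-∀
      lift : r ∼ σ h k [ ℓ ] → ∃[ s ] 1 ≤ s × r ∼ s *ℕ ℓ +ℕ σ h k [ N ]
      -- From r + uℓ = σ + vℓ one gets s = v - u, possibly negative. Adding (u + 1) N, with N = (b +
      -- 1) ℓ, pays for the uℓ and leaves 1 + b + ub further copies of ℓ, so `s` becomes positive.
      lift (congruent u v eq) = suc (b +ℕ v +ℕ u *ℕ b) , s≤s z≤n , congruent (suc u) 0
          (E.begin
            r +ℕ suc u *ℕ (c *ℕ ℓ)                           E.≡⟨ cong (λ z → r +ℕ suc u *ℕ (z *ℕ ℓ)) (ℕ.suc-pred c) ⟨
            r +ℕ suc u *ℕ (suc b *ℕ ℓ)                       E.≡⟨ expand r u b ℓ ⟩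
            (r +ℕ u *ℕ ℓ) +ℕ (suc b +ℕ u *ℕ b) *ℕ ℓ          E.≡⟨ cong (_+ℕ (suc b +ℕ u *ℕ b) *ℕ ℓ) eq ⟩
            (σ h k +ℕ v *ℕ ℓ) +ℕ (suc b +ℕ u *ℕ b) *ℕ ℓ        E.≡⟨ collect (σ h k) v b u ℓ ⟩
            suc (b +ℕ v +ℕ u *ℕ b) *ℕ ℓ +ℕ σ h k +ℕ 0          E.∎)
        where
        b = pred c
        module E = ≡-Reasoning
        expand : ∀ r u b l → r +ℕ suc u *ℕ (suc b *ℕ l) ≡ (r +ℕ u *ℕ l) +ℕ (suc b +ℕ u *ℕ b) *ℕ l
        expand = solve-∀
        collect : ∀ S v b u l → (S +ℕ v *ℕ l) +ℕ (suc b +ℕ u *ℕ b) *ℕ l ≡ suc (b +ℕ v +ℕ u *ℕ b) *ℕ l +ℕ S +ℕ 0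
        collect = solve-∀

    -- Multiplication by `q ^ h` fixes `s *ℕ ℓ` modulo `N` and increases `σ h k` by q - 1.
    geometric⇒exponent : ∀ k s → h *ℕ k ∼ 1 [ e ] → r ∼ s *ℕ ℓ +ℕ σ h k [ N ] →
                         r *ℕ q ^ h ∼ r +ℕ c [ N ]
    geometric⇒exponent k s hk∼1 r∼ = begin
        r *ℕ q ^ h                              ≈⟨ ∼-*-congʳ (q ^ h) r∼ ⟩
        (s *ℕ ℓ +ℕ σ h k) *ℕ q ^ h                ≡⟨ expand s ℓ (σ h k) (q ^ h) ⟩
        s *ℕ (ℓ *ℕ q ^ h) +ℕ σ h k *ℕ q ^ h       ≈⟨ ∼-+-cong (∼-*-congˡ s ℓ-absorbs) (σ-telescope k hk∼1) ⟩
        s *ℕ ℓ +ℕ (σ h k +ℕ c)                    ≡⟨ ℕ.+-assoc (s *ℕ ℓ) (σ h k) c ⟨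
        (s *ℕ ℓ +ℕ σ h k) +ℕ c                    ≈⟨ ∼-+-cong r∼ ∼-refl ⟨
        r +ℕ c                                  ∎
      where
      open SetoidReasoning (∼-setoid {N})
      expand : ∀ s l S x → (s *ℕ l +ℕ S) *ℕ x ≡ s *ℕ (l *ℕ x) +ℕ S *ℕ x
      expand = solve-∀
      q∼1 : q ∼ 1 [ c ]
      q∼1 = congruent 0 1 ≡.refl
      ℓ-absorbs : ℓ *ℕ q ^ h ∼ ℓ [ N ]
      ℓ-absorbs = subst₂ (ℓ *ℕ q ^ h ∼_[_]) (ℕ.*-identityʳ ℓ) (ℕ.*-comm ℓ c)
        (∼-scale ℓ (∼-^-1 h q∼1))

  Criterion : ℕ → Set
  Criterion r = ∃[ h ] ∃[ k ] ∃[ s ]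
    1 ≤ h × gcd h e ≡ 1 ×
    1 ≤ k × h *ℕ k ≅ 1 [mod e ] ×
    1 ≤ s ×
    r ≅ s *ℕ ℓ +ℕ σ h k [mod q ^ e ∸ 1 ]

  exponent⇒criterion : ∀ {r} → 2 ≤ e → ∃[ h ] 1 ≤ h × r *ℕ q ^ h ∼ r +ℕ c [ N ] → Criterion r
  exponent⇒criterion {r} 2≤e (h , 1≤h , rel) =
    let coprime = exponent⇒coprime r h 2≤e rel
        k , 1≤k , hk∼1 = ∼-inverse h e coprime
        s , 1≤s , r∼ = exponent⇒geometric r h k hk∼1 rel
    in h , k , s , 1≤h , coprime , 1≤k , ∼⇒≅ hk∼1 , 1≤s ,
       ∼⇒≅ (subst (r ∼ s *ℕ ℓ +ℕ σ h k [_]) (≡.sym q^e∸1≡N) r∼)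

  criterion⇒exponent : ∀ {r} → Criterion r → ∃[ h ] 1 ≤ h × r *ℕ q ^ h ∼ r +ℕ c [ N ]
  criterion⇒exponent {r} (h , k , s , 1≤h , _ , _ , hk≅1 , _ , r≅) =
    h , 1≤h , geometric⇒exponent r h k s (≅⇒∼ hk≅1)
      (subst (r ∼ s *ℕ ℓ +ℕ σ h k [_]) q^e∸1≡N (≅⇒∼ {a = r} {s *ℕ ℓ +ℕ σ h k} r≅))

-- Arithmetic of coefficient lists

module PolynomialProperties {c ℓ} (R : CommutativeRing c ℓ) where

  open CommutativeRing R hiding (zero)
  open Polynomials R
  open import Algebra.Properties.Ring ring
    using (-0#≈0#; -‿distribʳ-*; -‿+-comm; x∙y⁻¹≈ε⇒x≈y; -1*x≈-x; ⁻¹-anti-homo‿-)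
  open import Algebra.Properties.CommutativeSemigroup +-commutativeSemigroup using () renaming (interchange to +-interchange)
  open import Algebra.Properties.CommutativeSemigroup *-commutativeSemigroup using (x∙yz≈y∙xz)

  -- A record around _≈ₚ_, so that the two polynomials can be inferred from a proof.
  infix 4 _≋_
  record _≋_ (p p′ : Poly) : Set ℓ where
    constructor coefficientwise
    field
      coeff-≈ : p ≈ₚ p′

  open _≋_ public

  ≋-setoid : Setoid c ℓ
  ≋-setoid = record
    { _≈_           = _≋_
    ; isEquivalence = record
      { refl  = coefficientwise λ n → refl
      ; sym   = λ p≋p′ → coefficientwise λ n → sym (coeff-≈ p≋p′ n)
      ; trans = λ p≋p′ p′≋p″ → coefficientwise λ n → trans (coeff-≈ p≋p′ n) (coeff-≈ p′≋p″ n)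
      }
    }

  open Setoid ≋-setoid public using () renaming (refl to ≋-refl; sym to ≋-sym; trans to ≋-trans)

  private
    module ≈-Reasoning = SetoidReasoning setoid
    module ≋-Reasoning = SetoidReasoning ≋-setoid

  coeff-+ₚ : ∀ p p′ n → coeff (p +ₚ p′) n ≈ coeff p n + coeff p′ n
  coeff-+ₚ []      p′       n       = sym (+-identityˡ _)
  coeff-+ₚ (a ∷ p) []       n       = sym (+-identityʳ _)
  coeff-+ₚ (a ∷ p) (b ∷ p′) zero    = refl
  coeff-+ₚ (a ∷ p) (b ∷ p′) (suc n) = coeff-+ₚ p p′ n

  coeff--ₚ : ∀ p n → coeff (-ₚ p) n ≈ - coeff p n
  coeff--ₚ []      n       = sym -0#≈0#
  coeff--ₚ (a ∷ p) zero    = refl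
  coeff--ₚ (a ∷ p) (suc n) = coeff--ₚ p n

  coeff-scale : ∀ a p n → coeff (map (a *_) p) n ≈ a * coeff p n
  coeff-scale a []      n       = sym (zeroʳ a)
  coeff-scale a (b ∷ p) zero    = refl
  coeff-scale a (b ∷ p) (suc n) = coeff-scale a p n

  ∷-cong : ∀ {a a′ p p′} → a ≈ a′ → p ≋ p′ → a ∷ p ≋ a′ ∷ p′
  ∷-cong a≈a′ p≋p′ = coefficientwise λ { zero → a≈a′ ; (suc n) → coeff-≈ p≋p′ n }

  ≋-tail : ∀ {a b p p′} → a ∷ p ≋ b ∷ p′ → p ≋ p′
  ≋-tail ap≋bp′ = coefficientwise λ n → coeff-≈ ap≋bp′ (suc n)

  ≋[]-tail : ∀ {a p} → a ∷ p ≋ [] → p ≋ []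
  ≋[]-tail ap≋[] = coefficientwise λ n → coeff-≈ ap≋[] (suc n)

  0∷[]≋[] : 0# ∷ [] ≋ []
  0∷[]≋[] = coefficientwise λ { zero → refl ; (suc n) → refl }

  +ₚ-cong : ∀ {p p′ g g′} → p ≋ p′ → g ≋ g′ → p +ₚ g ≋ p′ +ₚ g′
  +ₚ-cong {p} {p′} {g} {g′} p≋p′ g≋g′ = coefficientwise λ n → begin
    coeff (p +ₚ g) n        ≈⟨ coeff-+ₚ p g n ⟩
    coeff p n + coeff g n   ≈⟨ +-cong (coeff-≈ p≋p′ n) (coeff-≈ g≋g′ n) ⟩
    coeff p′ n + coeff g′ n ≈⟨ coeff-+ₚ p′ g′ n ⟨
    coeff (p′ +ₚ g′) n      ∎
    where open ≈-Reasoning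

  -ₚ-cong : ∀ {p p′} → p ≋ p′ → (-ₚ p) ≋ (-ₚ p′)
  -ₚ-cong {p} {p′} p≋p′ = coefficientwise λ n → trans (coeff--ₚ p n) (trans (-‿cong (coeff-≈ p≋p′ n)) (sym (coeff--ₚ p′ n)))

  scale-cong : ∀ {a a′ p p′} → a ≈ a′ → p ≋ p′ → map (a *_) p ≋ map (a′ *_) p′
  scale-cong {a} {a′} {p} {p′} a≈a′ p≋p′ = coefficientwise λ n →
    trans (coeff-scale a p n) (trans (*-cong a≈a′ (coeff-≈ p≋p′ n)) (sym (coeff-scale a′ p′ n)))

  scale-0 : ∀ p → map (0# *_) p ≋ []
  scale-0 p = coefficientwise λ n → trans (coeff-scale 0# p n) (zeroˡ _)

  scale-1 : ∀ p → map (1# *_) p ≋ p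
  scale-1 p = coefficientwise λ n → trans (coeff-scale 1# p n) (*-identityˡ _)

  +ₚ-identityʳ : ∀ p → p +ₚ [] ≋ p
  +ₚ-identityʳ p = coefficientwise λ n → trans (coeff-+ₚ p [] n) (+-identityʳ _)

  *ₚ-congˡ : ∀ p {g g′} → g ≋ g′ → p *ₚ g ≋ p *ₚ g′
  *ₚ-congˡ []      g≋g′ = ≋-refl
  *ₚ-congˡ (a ∷ p) {g} {g′} g≋g′ = +ₚ-cong (scale-cong refl g≋g′) (∷-cong refl (*ₚ-congˡ p g≋g′))

  *ₚ-zeroˡ : ∀ p g → p ≋ [] → p *ₚ g ≋ []
  *ₚ-zeroˡ []      g p≋[] = ≋-refl
  *ₚ-zeroˡ (a ∷ p) g p≋[] = +ₚ-cong (≋-trans (scale-cong (coeff-≈ p≋[] 0) ≋-refl) (scale-0 g))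
    (≋-trans (∷-cong refl (*ₚ-zeroˡ p g (≋[]-tail p≋[]))) 0∷[]≋[])

  *ₚ-congʳ : ∀ p p′ g → p ≋ p′ → p *ₚ g ≋ p′ *ₚ g
  *ₚ-congʳ [] p′ g p≋p′ = ≋-sym (*ₚ-zeroˡ p′ g (≋-sym p≋p′))
  *ₚ-congʳ p@(_ ∷ _) [] g p≋p′ = *ₚ-zeroˡ p g p≋p′
  *ₚ-congʳ (a ∷ p) (b ∷ p′) g p≋p′ = +ₚ-cong (scale-cong (coeff-≈ p≋p′ 0) ≋-refl)
    (∷-cong refl (*ₚ-congʳ p p′ g (≋-tail p≋p′)))

  C-*ₚ : ∀ a g → C a *ₚ g ≋ map (a *_) g
  C-*ₚ a g = ≋-trans
    (+ₚ-cong ≋-refl 0∷[]≋[])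
    (+ₚ-identityʳ (map (a *_) g))

  -- Multiplication by X^k as padding. Monomials are kept in the form `shift k (C a)`, whose length
  -- and coefficients compute, instead of as products with `X ^ₚ k`.
  shift : ℕ → Poly → Poly
  shift zero    p = p
  shift (suc k) p = 0# ∷ shift k p

  shift-cong : ∀ k {p p′} → p ≋ p′ → shift k p ≋ shift k p′
  shift-cong zero    p≋p′ = p≋p′
  shift-cong (suc k) p≋p′ = ∷-cong refl (shift-cong k p≋p′)

  shift-shift : ∀ j k p → shift j (shift k p) ≡ shift (j +ℕ k) p
  shift-shift zero    k p = ≡.refl
  shift-shift (suc j) k p = cong (0# ∷_) (shift-shift j k p)

  shift-+ₚ : ∀ k p p′ → shift k (p +ₚ p′) ≋ shift k p +ₚ shift k p′
  shift-+ₚ zero    p p′ = ≋-refl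
  shift-+ₚ (suc k) p p′ = ∷-cong (sym (+-identityʳ 0#)) (shift-+ₚ k p p′)

  shift--ₚ : ∀ k p → shift k (-ₚ p) ≋ -ₚ shift k p
  shift--ₚ zero    p = ≋-refl
  shift--ₚ (suc k) p = ∷-cong (sym -0#≈0#) (shift--ₚ k p)

  scale-shift : ∀ a k p → map (a *_) (shift k p) ≋ shift k (map (a *_) p)
  scale-shift a zero    p = ≋-refl
  scale-shift a (suc k) p = ∷-cong (zeroʳ a) (scale-shift a k p)

  length-shift : ∀ k p → length (shift k p) ≡ k +ℕ length p
  length-shift zero    p = ≡.refl
  length-shift (suc k) p = cong suc (length-shift k p)

  coeff-shift : ∀ k a → coeff (shift k (C a)) k ≈ a
  coeff-shift zero    a = refl
  coeff-shift (suc k) a = coeff-shift k a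

  coeff-shift-≢ : ∀ k a n → n ≢ k → coeff (shift k (C a)) n ≈ 0#
  coeff-shift-≢ zero    a zero    n≢k = contradiction ≡.refl n≢k
  coeff-shift-≢ zero    a (suc n) n≢k = refl
  coeff-shift-≢ (suc k) a zero    n≢k = refl
  coeff-shift-≢ (suc k) a (suc n) n≢k = coeff-shift-≢ k a n λ n≡k → n≢k (cong suc n≡k)

  0∷-*ₚ : ∀ p g → (0# ∷ p) *ₚ g ≋ 0# ∷ p *ₚ g
  0∷-*ₚ p g = +ₚ-cong (scale-0 g) ≋-refl

  shift-*ₚ : ∀ k p g → shift k p *ₚ g ≋ shift k (p *ₚ g)
  shift-*ₚ zero    p g = ≋-refl
  shift-*ₚ (suc k) p g = ≋-trans
    (0∷-*ₚ (shift k p) g) (∷-cong refl (shift-*ₚ k p g))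

  1-*ₚ : ∀ g → C 1# *ₚ g ≋ g
  1-*ₚ g = ≋-trans (C-*ₚ 1# g) (scale-1 g)

  X^-shift : ∀ k → X ^ₚ k ≋ shift k (C 1#)
  X^-shift zero    = ≋-refl
  X^-shift (suc k) = begin
    X *ₚ X ^ₚ k           ≈⟨ 0∷-*ₚ (C 1#) (X ^ₚ k) ⟩
    0# ∷ C 1# *ₚ X ^ₚ k   ≈⟨ ∷-cong refl (1-*ₚ (X ^ₚ k)) ⟩
    0# ∷ X ^ₚ k           ≈⟨ ∷-cong refl (X^-shift k) ⟩
    0# ∷ shift k (C 1#)   ∎
    where open ≋-Reasoning

  X^-*ₚ : ∀ k g → X ^ₚ k *ₚ g ≋ shift k g
  X^-*ₚ k g = begin
    X ^ₚ k *ₚ g           ≈⟨ *ₚ-congʳ (X ^ₚ k) (shift k (C 1#)) g (X^-shift k) ⟩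
    shift k (C 1#) *ₚ g   ≈⟨ shift-*ₚ k (C 1#) g ⟩
    shift k (C 1# *ₚ g)   ≈⟨ shift-cong k (1-*ₚ g) ⟩
    shift k g             ∎
    where open ≋-Reasoning

  C-*ₚ-X^ : ∀ a k → C a *ₚ X ^ₚ k ≋ shift k (C a)
  C-*ₚ-X^ a k = begin
    C a *ₚ X ^ₚ k               ≈⟨ C-*ₚ a (X ^ₚ k) ⟩
    map (a *_) (X ^ₚ k)         ≈⟨ scale-cong refl (X^-shift k) ⟩
    map (a *_) (shift k (C 1#)) ≈⟨ scale-shift a k (C 1#) ⟩
    shift k (C (a * 1#))        ≈⟨ shift-cong k (∷-cong (*-identityʳ a) ≋-refl) ⟩
    shift k (C a)               ∎
    where open ≋-Reasoning

  0∷-∘ₚ-X^ : ∀ p n → (0# ∷ p) ∘ₚ (X ^ₚ n) ≋ shift n (p ∘ₚ (X ^ₚ n))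
  0∷-∘ₚ-X^ p n = +ₚ-cong 0∷[]≋[] (X^-*ₚ n (p ∘ₚ (X ^ₚ n)))

  shift-∘ₚ-X^ : ∀ k p n → shift k p ∘ₚ (X ^ₚ n) ≋ shift (k *ℕ n) (p ∘ₚ (X ^ₚ n))
  shift-∘ₚ-X^ zero    p n = ≋-refl
  shift-∘ₚ-X^ (suc k) p n = begin
    (0# ∷ shift k p) ∘ₚ (X ^ₚ n)              ≈⟨ 0∷-∘ₚ-X^ (shift k p) n ⟩
    shift n (shift k p ∘ₚ (X ^ₚ n))           ≈⟨ shift-cong n (shift-∘ₚ-X^ k p n) ⟩
    shift n (shift (k *ℕ n) (p ∘ₚ (X ^ₚ n)))  ≡⟨ shift-shift n (k *ℕ n) _ ⟩
    shift (n +ℕ k *ℕ n) (p ∘ₚ (X ^ₚ n))       ∎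
    where open ≋-Reasoning

  C-∘ₚ-X^ : ∀ a n → C a ∘ₚ (X ^ₚ n) ≋ C a
  C-∘ₚ-X^ a n = begin
    C a +ₚ X ^ₚ n *ₚ []  ≈⟨ +ₚ-cong ≋-refl (X^-*ₚ n []) ⟩
    C a +ₚ shift n []    ≈⟨ +ₚ-cong ≋-refl (shift-[] n) ⟩
    C a                  ∎
    where
    open ≋-Reasoning
    shift-[] : ∀ k → shift k [] ≋ []
    shift-[] zero    = ≋-refl
    shift-[] (suc k) = ≋-trans (∷-cong refl (shift-[] k)) 0∷[]≋[]

  coeff-minus : ∀ p p′ n → coeff (p -ₚ p′) n ≈ coeff p n - coeff p′ n
  coeff-minus p p′ n = trans (coeff-+ₚ p (-ₚ p′) n) (+-congˡ (coeff--ₚ p′ n))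

  shift-minus : ∀ j p p′ → shift j (p -ₚ p′) ≋ shift j p -ₚ shift j p′
  shift-minus j p p′ = ≋-trans
    (shift-+ₚ j p (-ₚ p′)) (+ₚ-cong ≋-refl (shift--ₚ j p′))

  minus-telescope : ∀ p p′ p″ → map (- 1# *_) (p -ₚ p′) +ₚ (p -ₚ p″) ≋ p′ -ₚ p″
  minus-telescope p p′ p″ = coefficientwise λ n → let x = coeff p n ; y = coeff p′ n ; z = coeff p″ n in begin
    coeff (map (- 1# *_) (p -ₚ p′) +ₚ (p -ₚ p″)) n             ≈⟨ coeff-+ₚ (map (- 1# *_) (p -ₚ p′)) (p -ₚ p″) n ⟩
    coeff (map (- 1# *_) (p -ₚ p′)) n + coeff (p -ₚ p″) n      ≈⟨ +-cong (coeff-scale (- 1#) (p -ₚ p′) n) (coeff-minus p p″ n) ⟩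
    - 1# * coeff (p -ₚ p′) n + (x - z)                         ≈⟨ +-congʳ (trans (-1*x≈-x _) (-‿cong (coeff-minus p p′ n))) ⟩
    - (x - y) + (x - z)                                        ≈⟨ +-congʳ (⁻¹-anti-homo‿- x y) ⟩
    (y - x) + (x - z)                                          ≈⟨ +-assoc y (- x) (x - z) ⟩
    y + (- x + (x - z))                                        ≈⟨ +-congˡ (+-assoc (- x) x (- z)) ⟨
    y + ((- x + x) - z)                                        ≈⟨ +-congˡ (trans (+-congʳ (-‿inverseˡ x)) (+-identityˡ (- z))) ⟩
    y - z                                                      ≈⟨ coeff-minus p′ p″ n ⟨
    coeff (p′ -ₚ p″) n                                         ∎
    where open ≈-Reasoning

  -- The shape fits X^(r+c) + aX^r minus aX^r + X^(r q^h), where the common middle term drops out.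
  +ₚ-minus-cancel : ∀ p p′ p″ → (p +ₚ p′) -ₚ (p′ +ₚ p″) ≋ p -ₚ p″
  +ₚ-minus-cancel p p′ p″ = coefficientwise λ n → let x = coeff p n ; y = coeff p′ n ; z = coeff p″ n in begin
    coeff ((p +ₚ p′) -ₚ (p′ +ₚ p″)) n     ≈⟨ coeff-minus (p +ₚ p′) (p′ +ₚ p″) n ⟩
    coeff (p +ₚ p′) n - coeff (p′ +ₚ p″) n ≈⟨ +-cong (coeff-+ₚ p p′ n) (-‿cong (coeff-+ₚ p′ p″ n)) ⟩
    (x + y) - (y + z)                      ≈⟨ +-congˡ (-‿+-comm y z) ⟨
    (x + y) + (- y - z)                    ≈⟨ +-assoc x y _ ⟩
    x + (y + (- y - z))                    ≈⟨ +-congˡ (+-assoc y (- y) (- z)) ⟨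
    x + ((y - y) - z)                      ≈⟨ +-congˡ (trans (+-congʳ (-‿inverseʳ y)) (+-identityˡ (- z))) ⟩
    x - z                                  ≈⟨ coeff-minus p p″ n ⟨
    coeff (p -ₚ p″) n                      ∎
    where open ≈-Reasoning

  -- Exponents may grow by multiples of `N` modulo X^(N+1) - X provided they start at 1 or more,
  -- hence `suc j`: at 0 the modulus vanishes while 1 - X^N does not.
  X^-congruent : ∀ N .{{_ : NonZero N}} j t →
    ∃[ g ] g *ₚ (X ^ₚ suc N -ₚ X) ≋ shift (suc j) (C 1#) -ₚ shift (suc j +ℕ t *ℕ N) (C 1#)
  X^-congruent (suc N) j t = shift j (quotient t) , (begin
    shift j (quotient t) *ₚ M                               ≈⟨ shift-*ₚ j (quotient t) M ⟩
    shift j (quotient t *ₚ M)                               ≈⟨ shift-cong j (quotient-* t) ⟩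
    shift j (mono 1 -ₚ mono (suc (t *ℕ suc N)))             ≈⟨ shift-minus j (mono 1) (mono (suc (t *ℕ suc N))) ⟩
    shift j (mono 1) -ₚ shift j (mono (suc (t *ℕ suc N)))   ≡⟨ cong₂ _-ₚ_ (shift-shift j 1 _) (shift-shift j (suc (t *ℕ suc N)) _) ⟩
    mono (j +ℕ 1) -ₚ mono (j +ℕ suc (t *ℕ suc N))           ≡⟨ cong₂ (λ u v → mono u -ₚ mono v) (ℕ.+-comm j 1) (ℕ.+-suc j (t *ℕ suc N)) ⟩
    mono (suc j) -ₚ mono (suc j +ℕ t *ℕ suc N)              ∎)
    where
    open ≋-Reasoning
    mono : ℕ → Poly
    mono k = shift k (C 1#)
    M : Poly
    M = X ^ₚ suc (suc N) -ₚ X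
    -- This is the negated sum of X^(i (N+1)) over i < t, where N + 1 is the original `N` after the
    -- match; its product with `M` telescopes.
    quotient : ℕ → Poly
    quotient zero    = []
    quotient (suc t) = - 1# ∷ shift N (quotient t)
    quotient-* : ∀ t → quotient t *ₚ M ≋ mono 1 -ₚ mono (suc (t *ℕ suc N))
    quotient-* zero = coefficientwise λ n → sym (trans (coeff-minus (mono 1) (mono 1) n) (-‿inverseʳ _))
    quotient-* (suc t) = begin
      map (- 1# *_) M +ₚ shift 1 (shift N (quotient t) *ₚ M)
        ≈⟨ +ₚ-cong (scale-cong refl (+ₚ-cong (X^-shift (suc (suc N))) ≋-refl))
             (≋-trans
               (shift-cong 1 (shift-*ₚ N (quotient t) M)) (shift-cong (suc N) (quotient-* t))) ⟩
      map (- 1# *_) (mono (2 +ℕ N) -ₚ mono 1) +ₚ shift (suc N) (mono 1 -ₚ mono (suc (t *ℕ suc N)))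
        ≈⟨ +ₚ-cong {map (- 1# *_) (mono (2 +ℕ N) -ₚ mono 1)} ≋-refl (shift-minus (suc N) (mono 1) (mono (suc (t *ℕ suc N)))) ⟩
      map (- 1# *_) (mono (2 +ℕ N) -ₚ mono 1) +ₚ (shift (suc N) (mono 1) -ₚ shift (suc N) (mono (suc (t *ℕ suc N))))
        ≡⟨ cong₂ (λ u v → map (- 1# *_) (mono (2 +ℕ N) -ₚ mono 1) +ₚ (u -ₚ v))
             (≡.trans (shift-shift (suc N) 1 (C 1#)) (cong mono (ℕ.+-comm (suc N) 1)))
             (≡.trans (shift-shift (suc N) (suc (t *ℕ suc N)) (C 1#)) (cong mono (ℕ.+-suc (suc N) (t *ℕ suc N)))) ⟩
      map (- 1# *_) (mono (2 +ℕ N) -ₚ mono 1) +ₚ (mono (2 +ℕ N) -ₚ mono (suc (suc t *ℕ suc N)))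
        ≈⟨ minus-telescope (mono (2 +ℕ N)) (mono 1) (mono (suc (suc t *ℕ suc N))) ⟩
      mono 1 -ₚ mono (suc (suc t *ℕ suc N)) ∎

  -- Evaluation of polynomials

  eval-zero : ∀ p x → p ≋ [] → eval p x ≈ 0#
  eval-zero []      x p≋[] = refl
  eval-zero (a ∷ p) x p≋[] = trans
    (+-cong (coeff-≈ p≋[] 0) (trans (*-congˡ (eval-zero p x (≋[]-tail p≋[]))) (zeroʳ x))) (+-identityʳ 0#)

  eval-cong : ∀ p p′ x → p ≋ p′ → eval p x ≈ eval p′ x
  eval-cong []        p′       x p≋p′ = sym (eval-zero p′ x (≋-sym p≋p′))
  eval-cong p@(_ ∷ _) []       x p≋p′ = eval-zero p x p≋p′
  eval-cong (a ∷ p)   (b ∷ p′) x p≋p′ = +-cong (coeff-≈ p≋p′ 0) (*-congˡ (eval-cong p p′ x (≋-tail p≋p′)))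

  eval-+ₚ : ∀ p p′ x → eval (p +ₚ p′) x ≈ eval p x + eval p′ x
  eval-+ₚ []      p′       x = sym (+-identityˡ _)
  eval-+ₚ (a ∷ p) []       x = sym (+-identityʳ _)
  eval-+ₚ (a ∷ p) (b ∷ p′) x = begin
    a + b + x * eval (p +ₚ p′) x                ≈⟨ +-congˡ (*-congˡ (eval-+ₚ p p′ x)) ⟩
    a + b + x * (eval p x + eval p′ x)          ≈⟨ +-congˡ (distribˡ x _ _) ⟩
    a + b + (x * eval p x + x * eval p′ x)      ≈⟨ +-interchange a b _ _ ⟩
    (a + x * eval p x) + (b + x * eval p′ x)    ∎
    where open ≈-Reasoning

  eval--ₚ : ∀ p x → eval (-ₚ p) x ≈ - eval p x
  eval--ₚ []      x = sym -0#≈0#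
  eval--ₚ (a ∷ p) x = begin
    - a + x * eval (-ₚ p) x   ≈⟨ +-congˡ (trans (*-congˡ (eval--ₚ p x)) (sym (-‿distribʳ-* x _))) ⟩
    - a + - (x * eval p x)    ≈⟨ -‿+-comm a _ ⟩
    - (a + x * eval p x)      ∎
    where open ≈-Reasoning

  eval-scale : ∀ a p x → eval (map (a *_) p) x ≈ a * eval p x
  eval-scale a []      x = sym (zeroʳ a)
  eval-scale a (b ∷ p) x = begin
    a * b + x * eval (map (a *_) p) x   ≈⟨ +-congˡ (*-congˡ (eval-scale a p x)) ⟩
    a * b + x * (a * eval p x)          ≈⟨ +-congˡ (x∙yz≈y∙xz x a _) ⟩
    a * b + a * (x * eval p x)          ≈⟨ distribˡ a b _ ⟨
    a * (b + x * eval p x)              ∎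
    where open ≈-Reasoning

  eval-*ₚ : ∀ p g x → eval (p *ₚ g) x ≈ eval p x * eval g x
  eval-*ₚ []      g x = sym (zeroˡ _)
  eval-*ₚ (a ∷ p) g x = begin
    eval (map (a *_) g +ₚ (0# ∷ p *ₚ g)) x             ≈⟨ eval-+ₚ (map (a *_) g) (0# ∷ p *ₚ g) x ⟩
    eval (map (a *_) g) x + (0# + x * eval (p *ₚ g) x) ≈⟨ +-cong (eval-scale a g x) (+-identityˡ _) ⟩
    a * eval g x + x * eval (p *ₚ g) x                 ≈⟨ +-congˡ (*-congˡ (eval-*ₚ p g x)) ⟩
    a * eval g x + x * (eval p x * eval g x)           ≈⟨ +-congˡ (*-assoc x _ _) ⟨
    a * eval g x + x * eval p x * eval g x             ≈⟨ distribʳ (eval g x) a _ ⟨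
    (a + x * eval p x) * eval g x                      ∎
    where open ≈-Reasoning

  eval-C : ∀ a x → eval (C a) x ≈ a
  eval-C a x = trans (+-congˡ (zeroʳ x)) (+-identityʳ a)

  eval-X : ∀ x → eval X x ≈ x
  eval-X x = trans (+-identityˡ _) (trans (*-congˡ (eval-C 1# x)) (*-identityʳ x))

  eval-^ₚ : ∀ p k x → eval (p ^ₚ k) x ≈ eval p x ^ᴿ k
  eval-^ₚ p zero    x = eval-C 1# x
  eval-^ₚ p (suc k) x = trans (eval-*ₚ p (p ^ₚ k) x) (*-congˡ (eval-^ₚ p k x))

  ^ᴿ-cong : ∀ k {x y} → x ≈ y → x ^ᴿ k ≈ y ^ᴿ k
  ^ᴿ-cong zero    x≈y = refl
  ^ᴿ-cong (suc k) x≈y = *-cong x≈y (^ᴿ-cong k x≈y)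

  eval-X^ : ∀ k x → eval (X ^ₚ k) x ≈ x ^ᴿ k
  eval-X^ k x = trans (eval-^ₚ X k x) (^ᴿ-cong k (eval-X x))

  eval-∘ₚ : ∀ p g x → eval (p ∘ₚ g) x ≈ eval p (eval g x)
  eval-∘ₚ []      g x = refl
  eval-∘ₚ (a ∷ p) g x = begin
    eval (C a +ₚ g *ₚ (p ∘ₚ g)) x               ≈⟨ eval-+ₚ (C a) (g *ₚ (p ∘ₚ g)) x ⟩
    eval (C a) x + eval (g *ₚ (p ∘ₚ g)) x       ≈⟨ +-cong (eval-C a x) (eval-*ₚ g (p ∘ₚ g) x) ⟩
    a + eval g x * eval (p ∘ₚ g) x              ≈⟨ +-congˡ (*-congˡ (eval-∘ₚ p g x)) ⟩
    a + eval g x * eval p (eval g x)            ∎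
    where open ≈-Reasoning

  eval-shift : ∀ k p x → eval (shift k p) x ≈ x ^ᴿ k * eval p x
  eval-shift zero    p x = sym (*-identityˡ _)
  eval-shift (suc k) p x = begin
    0# + x * eval (shift k p) x   ≈⟨ +-identityˡ _ ⟩
    x * eval (shift k p) x        ≈⟨ *-congˡ (eval-shift k p x) ⟩
    x * (x ^ᴿ k * eval p x)       ≈⟨ *-assoc x _ _ ⟨
    x * x ^ᴿ k * eval p x         ∎
    where open ≈-Reasoning

  -- Linear factors and the bound on the number of roots

  -- Synthetic division of p by X - α.
  divide : Poly → Carrier → Poly
  divide []          α = []
  divide (a ∷ [])    α = []
  divide (a ∷ p@(_ ∷ _)) α = eval p α ∷ divide p α

  length-divide : ∀ p α → length (divide p α) ≡ pred (length p)
  length-divide []              α = ≡.refl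
  length-divide (a ∷ [])        α = ≡.refl
  length-divide (a ∷ p@(_ ∷ _)) α = cong suc (length-divide p α)

  eval-divide : ∀ p α x → eval p x ≈ eval p α + (x - α) * eval (divide p α) x
  eval-divide [] α x = sym (trans (+-identityˡ _) (zeroʳ _))
  eval-divide (a ∷ []) α x = begin
    a + x * 0#                        ≈⟨ +-congˡ (trans (zeroʳ x) (sym (zeroʳ α))) ⟩
    a + α * 0#                        ≈⟨ +-identityʳ _ ⟨
    a + α * 0# + 0#                   ≈⟨ +-congˡ (zeroʳ (x - α)) ⟨
    a + α * 0# + (x - α) * 0#         ∎
    where open ≈-Reasoning
  eval-divide (a ∷ p@(_ ∷ _)) α x = begin
    a + x * eval p x                              ≈⟨ +-congˡ (*-congˡ (eval-divide p α x)) ⟩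
    a + x * (P + (x - α) * D)                     ≈⟨ +-congˡ (distribˡ x P _) ⟩
    a + (x * P + x * ((x - α) * D))               ≈⟨ +-congˡ (+-cong (*-congʳ x≈α+) (x∙yz≈y∙xz x (x - α) D)) ⟩
    a + ((α + (x - α)) * P + (x - α) * (x * D))   ≈⟨ +-congˡ (+-congʳ (distribʳ P α (x - α))) ⟩
    a + ((α * P + (x - α) * P) + (x - α) * (x * D)) ≈⟨ +-congˡ (+-assoc _ _ _) ⟩
    a + (α * P + ((x - α) * P + (x - α) * (x * D))) ≈⟨ +-assoc a _ _ ⟨
    a + α * P + ((x - α) * P + (x - α) * (x * D)) ≈⟨ +-congˡ (distribˡ (x - α) P (x * D)) ⟨
    a + α * P + (x - α) * (P + x * D)             ∎
    where
    open ≈-Reasoning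
    P = eval p α
    D = eval (divide p α) x
    x≈α+ : x ≈ α + (x - α)
    x≈α+ = begin
      x               ≈⟨ +-identityʳ x ⟨
      x + 0#          ≈⟨ +-congˡ (-‿inverseˡ α) ⟨
      x + (- α + α)   ≈⟨ +-assoc x (- α) α ⟨
      x - α + α       ≈⟨ +-comm (x - α) α ⟩
      α + (x - α)     ∎

  -- The coefficients of the quotient are the Horner values at α of the proper tails of p. If these
  -- and p(α) all vanish, the coefficients of p vanish one after another.
  divide-zero : ∀ p α → eval p α ≈ 0# → divide p α ≋ [] → p ≋ []
  divide-zero [] α p[α]≈0 d≋[] = ≋-refl
  divide-zero (a ∷ []) α p[α]≈0 d≋[] =
    ≋-trans (∷-cong (trans (sym (trans (+-congˡ (zeroʳ α)) (+-identityʳ a))) p[α]≈0) ≋-refl) 0∷[]≋[]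
  divide-zero (a ∷ p@(_ ∷ _)) α p[α]≈0 d≋[] =
    ≋-trans (∷-cong a≈0 (divide-zero p α p[α]≈0′ (≋[]-tail d≋[]))) 0∷[]≋[]
    where
    open ≈-Reasoning
    p[α]≈0′ = coeff-≈ d≋[] 0
    a≈0 : a ≈ 0#
    a≈0 = begin
      a                   ≈⟨ +-identityʳ a ⟨
      a + 0#              ≈⟨ +-congˡ (trans (*-congˡ p[α]≈0′) (zeroʳ α)) ⟨
      a + α * eval p α    ≈⟨ p[α]≈0 ⟩
      0#                  ∎

  -- Dividing by X - ρ(0) shortens the list by one, and the quotient still vanishes at the other
  -- roots, since these differ from ρ(0) and there are no zero divisors. Bounding the length instead
  -- of the degree makes trailing zeros harmless.
  roots⇒zero : (∀ x y → x ≉ 0# → x * y ≈ 0# → y ≈ 0#) →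
               ∀ n (ρ : Fin n → Carrier) → (∀ i j → ρ i ≈ ρ j → i ≡ j) →
               ∀ p → length p ≤ n → (∀ i → eval p (ρ i) ≈ 0#) → p ≋ []
  roots⇒zero domain zero    ρ ρ-injective []      z≤n p[ρ]≈0 = ≋-refl
  roots⇒zero domain (suc n) ρ ρ-injective p ∣p∣≤1+n p[ρ]≈0 =
    divide-zero p α (p[ρ]≈0 zero)
      (roots⇒zero domain n (λ i → ρ (suc i)) (λ i j eq → Fin.suc-injective (ρ-injective (suc i) (suc j) eq))
        (divide p α) (≡.subst (_≤ n) (≡.sym (length-divide p α)) (ℕ.pred-mono-≤ ∣p∣≤1+n)) vanishes)
    where
    open ≈-Reasoning
    α = ρ zero
    vanishes : ∀ i → eval (divide p α) (ρ (suc i)) ≈ 0#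
    vanishes i = domain (ρ (suc i) - α) _
      (λ eq → contradiction (ρ-injective (suc i) zero (x∙y⁻¹≈ε⇒x≈y _ _ eq)) λ ())
      (begin
        (ρ (suc i) - α) * eval (divide p α) (ρ (suc i))              ≈⟨ +-identityˡ _ ⟨
        0# + (ρ (suc i) - α) * eval (divide p α) (ρ (suc i))         ≈⟨ +-congʳ (p[ρ]≈0 zero) ⟨
        eval p α + (ρ (suc i) - α) * eval (divide p α) (ρ (suc i))   ≈⟨ eval-divide p α (ρ (suc i)) ⟨
        eval p (ρ (suc i))                                           ≈⟨ p[ρ]≈0 (suc i) ⟩
        0#                                                           ∎)

-- Binomial coefficients modulo a prime

p∤k! : ∀ {p} → Prime p → ∀ k → k < p → ¬ p ∣ k !
p∤k! p-prime zero    0<p p∣1  = ¬prime[1] (subst Prime (∣.∣1⇒≡1 p∣1) p-prime)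
p∤k! p-prime (suc k) k<p p∣k! with euclidsLemma (suc k) (k !) p-prime p∣k!
... | inj₁ p∣1+k = ℕ.<⇒≱ k<p (∣.∣⇒≤ p∣1+k)
... | inj₂ p∣k!′ = p∤k! p-prime k (ℕ.<-trans (ℕ.n<1+n k) k<p) p∣k!′

-- The prime divides p! = C(p,k) k! (p-k)!, but neither factorial, since all their factors lie below
-- p.
p∣pCk : ∀ {p} → Prime p → ∀ k → 0 < k → k < p → p ∣ p choose k
p∣pCk {p@(suc p-1)} p-prime k@(suc k-1) 0<k k<p with euclidsLemma (p choose k) (k ! *ℕ (p ∸ k) !) p-prime p∣product
  where
  k≤p = ℕ.<⇒≤ k<p
  instance
    k![p∸k]!≢0 : NonZero (k ! *ℕ (p ∸ k) !)
    k![p∸k]!≢0 = k ℕ.!* (p ∸ k) !≢0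
  product≡p! : (p choose k) *ℕ (k ! *ℕ (p ∸ k) !) ≡ p !
  product≡p! = ≡.trans (cong (_*ℕ (k ! *ℕ (p ∸ k) !)) (nCk≡n!/k![n-k]! k≤p)) (m/n*n≡m (k![n∸k]!∣n! k≤p))
  p∣product : p ∣ (p choose k) *ℕ (k ! *ℕ (p ∸ k) !)
  p∣product = subst (p ∣_) (≡.sym product≡p!) (∣.m∣m*n (p-1 !))
... | inj₁ p∣C = p∣C
... | inj₂ p∣k![p∸k]! with euclidsLemma (k !) ((p ∸ k) !) p-prime p∣k![p∸k]!
... | inj₁ p∣k! = contradiction p∣k! (p∤k! p-prime k k<p)
... | inj₂ p∣[p∸k]! = contradiction p∣[p∸k]! (p∤k! p-prime (p ∸ k) (s≤s (ℕ.m∸n≤m p-1 k-1)))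

-- Fields with N + 1 elements

module FiniteField {c ℓ₁ ℓ₂} (F : HeytingField c ℓ₁ ℓ₂) (N : ℕ) where

  open CommutativeRing (fieldRing F) hiding (zero)
  open Polynomials (fieldRing F)
  open PolynomialProperties (fieldRing F)
  open import Algebra.Properties.CommutativeSemiring.Exp commutativeSemiring
    using (^-homo-*; ^-assocʳ)
  open import Algebra.Properties.Semiring.Mult semiring
    using (×-homo-1; ×-assocˡ; ×-assoc-*; ×-congˡ; ×-congʳ; ×1-homo-*)
    renaming (_×_ to _·_)
  open import Algebra.Properties.Ring ring using (+-identityʳ-unique; -0#≈0#)

  module _ (card : HasCardinality setoid (suc N)) where

    open Inverse card using (to; from; to-cong; strictlyInverseˡ; strictlyInverseʳ)

    open SetoidReasoning setoid

    to-injective : ∀ {x y} → to x ≡ to y → x ≈ y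
    to-injective {x} {y} eq = begin
      x            ≈⟨ strictlyInverseʳ x ⟨
      from (to x)  ≡⟨ cong from eq ⟩
      from (to y)  ≈⟨ strictlyInverseʳ y ⟩
      y            ∎

    from-injective : ∀ i j → from i ≈ from j → i ≡ j
    from-injective i j eq = ≡.trans (≡.sym (strictlyInverseˡ i)) (≡.trans (to-cong eq) (strictlyInverseˡ j))

    infix 4 _≟_
    _≟_ : ∀ x y → Dec (x ≈ y)
    x ≟ y = map′ to-injective to-cong (to x Fin.≟ to y)

    -- A Heyting field inverts elements apart from 0, whereas only `x ≉ 0#` is given. Inverses are
    -- therefore searched for among all elements; if none is found, `x` cannot be apart from 0, and
    -- tightness makes it 0.
    inverse : ∀ x → x ≉ 0# → ∃[ y ] x * y ≈ 1#
    inverse x x≉0 with Fin.any? (λ i → x * from i ≟ 1#)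
    ... | yes (i , eq) = from i , eq
    ... | no ¬inverse  = contradiction (proj₁ (HeytingField.tight F x 0#) ¬x#0) x≉0
      where
      ¬x#0 : ¬ HeytingField._#_ F x 0#
      ¬x#0 x#0 with HeytingField.#⇒invertible F x#0
      ... | y , _ , [x-0]y≈1 = ¬inverse (to y , (begin
        x * from (to y)   ≈⟨ *-cong (sym (trans (+-congˡ -0#≈0#) (+-identityʳ x))) (strictlyInverseʳ y) ⟩
        (x - 0#) * y      ≈⟨ [x-0]y≈1 ⟩
        1#                ∎))

    *-cancelˡ : ∀ {x y z} → x ≉ 0# → x * y ≈ x * z → y ≈ z
    *-cancelˡ {x} {y} {z} x≉0 xy≈xz with inverse x x≉0
    ... | x′ , xx′≈1 = begin
      y             ≈⟨ cancel y ⟨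
      x′ * (x * y)  ≈⟨ *-congˡ xy≈xz ⟩
      x′ * (x * z)  ≈⟨ cancel z ⟩
      z             ∎
      where
      cancel : ∀ y → x′ * (x * y) ≈ y
      cancel y = begin
        x′ * (x * y)  ≈⟨ *-assoc x′ x y ⟨
        x′ * x * y    ≈⟨ *-congʳ (trans (*-comm x′ x) xx′≈1) ⟩
        1# * y        ≈⟨ *-identityˡ y ⟩
        y             ∎

    domain : ∀ x y → x ≉ 0# → x * y ≈ 0# → y ≈ 0#
    domain x y x≉0 xy≈0 = *-cancelˡ x≉0 (trans xy≈0 (sym (zeroʳ x)))

    -- Pigeonhole: if a value y were missed, deleting its index would inject `Fin (suc N)` into
    -- `Fin N`.
    injective⇒bijective : ∀ {f : Carrier → Carrier} → Congruent _≈_ _≈_ f → Injective _≈_ _≈_ f → Bijective _≈_ _≈_ f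
    injective⇒bijective {f} f-cong f-injective = f-injective , surjective
      where
      g : Fin (suc N) → Fin (suc N)
      g i = to (f (from i))
      g-injective : ∀ {i j} → g i ≡ g j → i ≡ j
      g-injective eq = from-injective _ _ (f-injective (to-injective eq))
      surjective : ∀ y → ∃[ x ] (∀ {z} → z ≈ x → f z ≈ y)
      surjective y with Fin.any? (λ i → to y Fin.≟ g i)
      ... | yes (i , eq) = from i , λ z≈x → trans (f-cong z≈x) (to-injective (≡.sym eq))
      ... | no ¬image = contradiction (Fin.injective⇒≤ {f = h} h-injective) (ℕ.<-irrefl ≡.refl)
        where
        y≢g : ∀ i → to y ≢ g i
        y≢g i eq = ¬image (i , eq)
        h : Fin (suc N) → Fin N
        h i = punchOut (y≢g i)
        h-injective : ∀ {i j} → h i ≡ h j → i ≡ j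
        h-injective {i} {j} eq = g-injective (Fin.punchOut-injective (y≢g i) (y≢g j) eq)

    -- Prepending a zero coefficient multiplies p by X, which makes 0 a root as well; the full
    -- enumeration `from` then supplies `suc N` distinct roots for a list of length at most `suc N`.
    vanishing⇒zero : ∀ p → length p ≤ N → (∀ x → x ≉ 0# → eval p x ≈ 0#) → p ≋ []
    vanishing⇒zero p ∣p∣≤N vanishes = ≋[]-tail (roots⇒zero domain (suc N) from from-injective (0# ∷ p) (s≤s ∣p∣≤N) vanishes′)
      where
      vanishes′ : ∀ i → eval (0# ∷ p) (from i) ≈ 0#
      vanishes′ i with from i ≟ 0#
      ... | yes x≈0 = trans (+-identityˡ _) (trans (*-congʳ x≈0) (zeroˡ _))
      ... | no  x≉0 = trans (+-identityˡ _) (trans (*-congˡ (vanishes _ x≉0)) (zeroʳ _))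

    -- Translation by 1 permutes the field, so the sum of all elements does not change when
    -- `suc N · 1#` is added to it.
    [1+N]×1≈0 : suc N · 1# ≈ 0#
    [1+N]×1≈0 = +-identityʳ-unique (∑ from) (suc N · 1#) (begin
        ∑ from + suc N · 1#                    ≈⟨ +-congˡ (sum-replicate (suc N)) ⟨
        ∑ from + ∑ {suc N} (λ _ → 1#)        ≈⟨ ∑-distrib-+ from (λ _ → 1#) ⟨
        ∑ (λ i → from i + 1#)                  ≈⟨ sum-cong-≋ (λ i → strictlyInverseʳ (from i + 1#)) ⟨
        ∑ (λ i → from (to (from i + 1#)))      ≈⟨ sum-permute from translate ⟨
        ∑ from                                 ∎)
      where
      open Sum +-commutativeMonoid using (sum-replicate; ∑-distrib-+; sum-cong-≋; sum-permute) renaming (sum to ∑)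
      open import Algebra.Properties.Group +-group using (//-rightDividesˡ; //-rightDividesʳ)
      translate : Permutation (suc N) (suc N)
      translate = permutation (λ i → to (from i + 1#)) (λ i → to (from i - 1#))
        (λ i → ≡.trans (to-cong (trans (+-congʳ (strictlyInverseʳ _)) (//-rightDividesˡ 1# (from i)))) (strictlyInverseˡ i))
        (λ i → ≡.trans (to-cong (trans (+-congʳ (strictlyInverseʳ _)) (//-rightDividesʳ 1# (from i)))) (strictlyInverseˡ i))

    module _ (1≉0 : 1# ≉ 0#) where

      *-≉0 : ∀ {x y} → x ≉ 0# → y ≉ 0# → x * y ≉ 0#
      *-≉0 x≉0 y≉0 xy≈0 = y≉0 (domain _ _ x≉0 xy≈0)

      ^-≉0 : ∀ {x} k → x ≉ 0# → x ^ᴿ k ≉ 0#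
      ^-≉0 zero    x≉0 = 1≉0
      ^-≉0 (suc k) x≉0 = *-≉0 x≉0 (^-≉0 k x≉0)

      private
        -- Lets a product over the nonzero elements run over all of `Fin (suc N)`, with a harmless
        -- factor at the index of 0.
        ifZero : Carrier → Carrier → Carrier → Carrier
        ifZero x u v with x ≟ 0#
        ... | yes _ = u
        ... | no  _ = v

        ifZero-yes : ∀ {x} u v → x ≈ 0# → ifZero x u v ≈ u
        ifZero-yes {x} u v x≈0 with x ≟ 0#
        ... | yes _   = refl
        ... | no  x≉0 = contradiction x≈0 x≉0

        ifZero-no : ∀ {x} u v → x ≉ 0# → ifZero x u v ≈ v
        ifZero-no {x} u v x≉0 with x ≟ 0#
        ... | yes x≈0 = contradiction x≈0 x≉0
        ... | no  _   = refl

      -- Multiplication by x permutes the field, so it leaves the product of the nonzero elements unchanged.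
      fermat : ∀ {x} → x ≉ 0# → x ^ᴿ N ≈ 1#
      fermat {x} x≉0 with inverse x x≉0
      ... | x′ , xx′≈1 = begin
          x ^ᴿ N                                                ≈⟨ product-replicate N ⟨
          product {N} (λ _ → x)                                 ≈⟨ product-cong (λ i → ifZero-no 1# x (i≢i₀⇒≉0 (Fin.punchInᵢ≢i i₀ i))) ⟨
          product (λ i → factor (punchIn i₀ i))                 ≈⟨ *-identityˡ _ ⟨
          1# * product (λ i → factor (punchIn i₀ i))            ≈⟨ *-congʳ (ifZero-yes 1# x (strictlyInverseʳ 0#)) ⟨
          factor i₀ * product (λ i → factor (punchIn i₀ i))     ≈⟨ product-remove {i = i₀} factor ⟨
          product factor                                        ≈⟨ *-cancelˡ product≉0 product-nonzero*product-factor ⟩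
          1#                                                    ∎
        where
        open Sum *-commutativeMonoid using () renaming
          ( sum to product; sum-replicate to product-replicate; sum-cong-≋ to product-cong
          ; sum-remove to product-remove; sum-permute to product-permute; ∑-distrib-+ to product-distrib)
        i₀ = to 0#
        i≢i₀⇒≉0 : ∀ {i} → i ≢ i₀ → from i ≉ 0#
        i≢i₀⇒≉0 {i} i≢i₀ eq = i≢i₀ (≡.trans (≡.sym (strictlyInverseˡ i)) (to-cong eq))
        factor nonzero : Fin (suc N) → Carrier
        factor i = ifZero (from i) 1# x
        nonzero i = ifZero (from i) 1# (from i)
        product-≉0 : ∀ n (g : Fin n → Carrier) → (∀ i → g i ≉ 0#) → product g ≉ 0#
        product-≉0 zero    g g≉0 = 1≉0
        product-≉0 (suc n) g g≉0 = *-≉0 (g≉0 zero) (product-≉0 n (g ∘ suc) (g≉0 ∘ suc))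
        nonzero≉0 : ∀ i → nonzero i ≉ 0#
        nonzero≉0 i eq with from i ≟ 0#
        ... | yes _   = 1≉0 eq
        ... | no  i≉0 = i≉0 eq
        product≉0 : product nonzero ≉ 0#
        product≉0 = product-≉0 (suc N) nonzero nonzero≉0
        cancel : ∀ {u v} → u * v ≈ 1# → ∀ y → u * (v * y) ≈ y
        cancel uv≈1 y = trans (sym (*-assoc _ _ y)) (trans (*-congʳ uv≈1) (*-identityˡ y))
        multiply : Permutation (suc N) (suc N)
        multiply = permutation (λ i → to (x * from i)) (λ i → to (x′ * from i))
          (λ i → ≡.trans (to-cong (trans (*-congˡ (strictlyInverseʳ _)) (cancel xx′≈1 (from i)))) (strictlyInverseˡ i))
          (λ i → ≡.trans (to-cong (trans (*-congˡ (strictlyInverseʳ _)) (cancel (trans (*-comm x′ x) xx′≈1) (from i)))) (strictlyInverseˡ i))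
        multiply-nonzero : ∀ i → nonzero (to (x * from i)) ≈ nonzero i * factor i
        multiply-nonzero i = byCases (from i ≟ 0#)
          where
          byCases : Dec (from i ≈ 0#) → nonzero (to (x * from i)) ≈ nonzero i * factor i
          byCases (yes i≈0) = begin
            nonzero (to (x * from i))  ≈⟨ ifZero-yes 1# _ (trans (strictlyInverseʳ _) (trans (*-congˡ i≈0) (zeroʳ x))) ⟩
            1#                         ≈⟨ *-identityʳ 1# ⟨
            1# * 1#                    ≈⟨ *-cong (ifZero-yes 1# (from i) i≈0) (ifZero-yes 1# x i≈0) ⟨
            nonzero i * factor i       ∎
          byCases (no i≉0) = begin
            nonzero (to (x * from i))  ≈⟨ ifZero-no 1# _ (λ eq → *-≉0 x≉0 i≉0 (trans (sym (strictlyInverseʳ _)) eq)) ⟩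
            from (to (x * from i))     ≈⟨ strictlyInverseʳ _ ⟩
            x * from i                 ≈⟨ *-comm x (from i) ⟩
            from i * x                 ≈⟨ *-cong (ifZero-no 1# (from i) i≉0) (ifZero-no 1# x i≉0) ⟨
            nonzero i * factor i       ∎
        product-nonzero*product-factor : product nonzero * product factor ≈ product nonzero * 1#
        product-nonzero*product-factor = begin
          product nonzero * product factor             ≈⟨ product-distrib nonzero factor ⟨
          product (λ i → nonzero i * factor i)         ≈⟨ product-cong multiply-nonzero ⟨
          product (λ i → nonzero (to (x * from i)))    ≈⟨ product-permute nonzero multiply ⟨
          product nonzero                              ≈⟨ *-identityʳ _ ⟨
          product nonzero * 1#                         ∎

      ^ᴿ-1 : ∀ k → 1# ^ᴿ k ≈ 1#
      ^ᴿ-1 zero    = refl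
      ^ᴿ-1 (suc k) = trans (*-identityˡ _) (^ᴿ-1 k)

      -- By `fermat`, adding multiples of `N` to an exponent does not change a power of x. At 0 this
      -- breaks down between the exponents 0 and `N`.
      ^ᴿ-∼ : ∀ {x} → x ≉ 0# → ∀ {i j} → i ∼ j [ N ] → x ^ᴿ i ≈ x ^ᴿ j
      ^ᴿ-∼ {x} x≉0 {i} {j} (congruent u v eq) = begin
        x ^ᴿ i                 ≈⟨ absorb i u ⟩
        x ^ᴿ (i +ℕ u *ℕ N)     ≡⟨ cong (x ^ᴿ_) eq ⟩
        x ^ᴿ (j +ℕ v *ℕ N)     ≈⟨ absorb j v ⟨
        x ^ᴿ j                 ∎
        where
        absorb : ∀ i u → x ^ᴿ i ≈ x ^ᴿ (i +ℕ u *ℕ N)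
        absorb i u = begin
          x ^ᴿ i                      ≈⟨ *-identityʳ _ ⟨
          x ^ᴿ i * 1#                 ≈⟨ *-congˡ (^ᴿ-1 u) ⟨
          x ^ᴿ i * 1# ^ᴿ u            ≈⟨ *-congˡ (^ᴿ-cong u (fermat x≉0)) ⟨
          x ^ᴿ i * (x ^ᴿ N) ^ᴿ u      ≈⟨ *-congˡ (^-assocʳ x N u) ⟩
          x ^ᴿ i * x ^ᴿ (N *ℕ u)      ≡⟨ cong (λ k → x ^ᴿ i * x ^ᴿ k) (ℕ.*-comm N u) ⟩
          x ^ᴿ i * x ^ᴿ (u *ℕ N)      ≈⟨ ^-homo-* x i (u *ℕ N) ⟨
          x ^ᴿ (i +ℕ u *ℕ N)          ∎

      -- The multiple `(p ^ t) · 1#` is the t-th power of `p · 1#` and vanishes by `[1+N]×1≈0`;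
      -- without zero divisors, so does `p · 1#`.
      characteristic : ∀ p t → p ^ t ≡ suc N → p · 1# ≈ 0#
      characteristic p t p^t≡1+N = root t (trans (×-congˡ p^t≡1+N) [1+N]×1≈0)
        where
        root : ∀ t → (p ^ t) · 1# ≈ 0# → p · 1# ≈ 0#
        root zero    1×1≈0 = contradiction (trans (sym (×-homo-1 1#)) 1×1≈0) 1≉0
        root (suc t) eq with p · 1# ≟ 0#
        ... | yes p×1≈0 = p×1≈0
        ... | no  p×1≉0 = root t (domain _ _ p×1≉0 (trans (sym (×1-homo-* p (p ^ t))) eq))

  -- Additivity of the Frobenius map

  module Frobenius {p} (p-prime : Prime p) (p×1≈0 : p · 1# ≈ 0#) where

    open import Algebra.Properties.CommutativeSemiring.Binomial commutativeSemiring
      using (theorem; binomialTerm)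
    open Sum +-commutativeMonoid using (sum-cong-≋; sum-init-last; sum-replicate-zero) renaming (sum to ∑)
    open SetoidReasoning setoid

    ∣⇒×≈0 : ∀ {m} → p ∣ m → ∀ x → m · x ≈ 0#
    ∣⇒×≈0 (divides w ≡.refl) x = begin
      (w *ℕ p) · x           ≈⟨ ×-assocˡ x w p ⟨
      w · (p · x)            ≈⟨ ×-congʳ w (×-congʳ p (*-identityˡ x)) ⟨
      w · (p · (1# * x))     ≈⟨ ×-congʳ w (×-assoc-* p 1# x) ⟨
      w · ((p · 1#) * x)     ≈⟨ ×-congʳ w (trans (*-congʳ p×1≈0) (zeroˡ x)) ⟩
      w · 0#                 ≈⟨ ×-0 w ⟩
      0#                     ∎
      where
      ×-0 : ∀ w → w · 0# ≈ 0#
      ×-0 zero    = refl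
      ×-0 (suc w) = trans (+-identityˡ _) (×-0 w)

    -- In the binomial expansion every coefficient except the two outer ones is divisible by p,
    -- hence kills the field.
    ^p-+ : ∀ x y → (x + y) ^ᴿ p ≈ x ^ᴿ p + y ^ᴿ p
    ^p-+ = go p ≡.refl
      where
      go : ∀ m → m ≡ p → ∀ x y → (x + y) ^ᴿ m ≈ x ^ᴿ m + y ^ᴿ m
      go zero ≡.refl = contradiction p-prime λ ()
      go m@(suc m-1) ≡.refl x y = begin
        (x + y) ^ᴿ m                          ≈⟨ theorem m x y ⟩
        term zero + ∑ (term ∘ suc)          ≈⟨ +-cong first (sum-init-last (term ∘ suc)) ⟩
        y ^ᴿ m + (∑ (λ i → term (suc (inject₁ i))) + term (suc (fromℕ m-1)))
          ≈⟨ +-congˡ (+-cong (trans (sum-cong-≋ middle) (sum-replicate-zero m-1)) last) ⟩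
        y ^ᴿ m + (0# + x ^ᴿ m)                ≈⟨ +-congˡ (+-identityˡ _) ⟩
        y ^ᴿ m + x ^ᴿ m                       ≈⟨ +-comm _ _ ⟩
        x ^ᴿ m + y ^ᴿ m                       ∎
        where
        term : Fin (suc m) → Carrier
        term = binomialTerm x y m
        first : term zero ≈ y ^ᴿ m
        first = begin
          (m choose 0) · (1# * y ^ᴿ m)   ≈⟨ ×-congˡ (≡.trans (nCk≡nC[n∸k] {0} {m} z≤n) (nCn≡1 m)) ⟩
          1 · (1# * y ^ᴿ m)         ≈⟨ ×-homo-1 _ ⟩
          1# * y ^ᴿ m               ≈⟨ *-identityˡ _ ⟩
          y ^ᴿ m                    ∎
        middle : ∀ i → term (suc (inject₁ i)) ≈ 0#
        middle i = ∣⇒×≈0 (p∣pCk p-prime (suc (toℕ (inject₁ i))) (s≤s z≤n)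
          (s≤s (subst (_< m-1) (≡.sym (Fin.toℕ-inject₁ i)) (Fin.toℕ<n i)))) _
        last : term (suc (fromℕ m-1)) ≈ x ^ᴿ m
        last = begin
          (m choose suc (toℕ (fromℕ m-1))) · (x ^ᴿ suc (toℕ (fromℕ m-1)) * y ^ᴿ (m ∸ suc (toℕ (fromℕ m-1))))
            ≡⟨ cong (λ k → (m choose suc k) · (x ^ᴿ suc k * y ^ᴿ (m-1 ∸ k))) (Fin.toℕ-fromℕ m-1) ⟩
          (m choose m) · (x ^ᴿ m * y ^ᴿ (m-1 ∸ m-1))
            ≈⟨ ×-congˡ (nCn≡1 m) ⟩
          1 · (x ^ᴿ m * y ^ᴿ (m-1 ∸ m-1))    ≈⟨ ×-homo-1 _ ⟩
          x ^ᴿ m * y ^ᴿ (m-1 ∸ m-1)          ≡⟨ cong (λ k → x ^ᴿ m * y ^ᴿ k) (ℕ.n∸n≡0 m-1) ⟩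
          x ^ᴿ m * 1#                        ≈⟨ *-identityʳ _ ⟩
          x ^ᴿ m                             ∎

    ^p^j-+ : ∀ j x y → (x + y) ^ᴿ (p ^ j) ≈ x ^ᴿ (p ^ j) + y ^ᴿ (p ^ j)
    ^p^j-+ zero x y = trans (*-identityʳ _) (+-cong (sym (*-identityʳ x)) (sym (*-identityʳ y)))
    ^p^j-+ (suc j) x y = begin
      (x + y) ^ᴿ (p *ℕ p ^ j)                        ≈⟨ ^-assocʳ (x + y) p (p ^ j) ⟨
      ((x + y) ^ᴿ p) ^ᴿ (p ^ j)                      ≈⟨ ^ᴿ-cong (p ^ j) (^p-+ x y) ⟩
      (x ^ᴿ p + y ^ᴿ p) ^ᴿ (p ^ j)                   ≈⟨ ^p^j-+ j (x ^ᴿ p) (y ^ᴿ p) ⟩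
      (x ^ᴿ p) ^ᴿ (p ^ j) + (y ^ᴿ p) ^ᴿ (p ^ j)      ≈⟨ +-cong (^-assocʳ x p (p ^ j)) (^-assocʳ y p (p ^ j)) ⟩
      x ^ᴿ (p *ℕ p ^ j) + y ^ᴿ (p *ℕ p ^ j)          ∎

-- The polynomial x^r (x^(q-1) + a)

module PermutationBinomial {c₀ ℓ₁ ℓ₂} (F : HeytingField c₀ ℓ₁ ℓ₂) (c e r : ℕ) .{{c≢0 : NonZero c}} (2≤e : 2 ≤ e) (1≤r : 1 ≤ r)
  (card : HasCardinality (CommutativeRing.setoid (fieldRing F)) (suc (Exponents.N c e)))
  (a : CommutativeRing.Carrier (fieldRing F))
  (a≉0 : CommutativeRing._≉_ (fieldRing F) a (CommutativeRing.0# (fieldRing F))) where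

  open CommutativeRing (fieldRing F) hiding (zero)
  open Exponents c e
  open Polynomials (fieldRing F)
  open PolynomialProperties (fieldRing F)
  open FiniteField F N
  open import Algebra.Properties.CommutativeSemiring.Exp commutativeSemiring
    using (^-homo-*; ^-assocʳ)
  open import Algebra.Properties.Ring ring
    using (x∙y⁻¹≈ε⇒x≈y; -‿+-comm; -‿distribˡ-*; +-inverseˡ-unique; +-identityˡ-unique; +-cancelʳ)
  open import Algebra.Properties.CommutativeSemigroup +-commutativeSemigroup using () renaming (interchange to +-interchange)
  open import Algebra.Properties.CommutativeSemigroup *-commutativeSemigroup using (x∙yz≈y∙xz)
  open import Algebra.Properties.Group +-group using (//-rightDividesˡ)
  open SetoidReasoning setoid

  1≉0 : 1# ≉ 0#
  1≉0 1≈0 = a≉0 (trans (sym (*-identityʳ a)) (trans (*-congˡ 1≈0) (zeroʳ a)))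

  instance
    ℓ≢0 : NonZero ℓ
    ℓ≢0 = >-nonZero (ℕ.<-trans (s≤s z≤n) (1<ℓ 2≤e))
    N≢0 : NonZero N
    N≢0 = ℕ.m*n≢0 c ℓ
    e≢0 : NonZero e
    e≢0 = >-nonZero (ℕ.<-trans (s≤s z≤n) 2≤e)

  f : Poly
  f = X ^ₚ r *ₚ (X ^ₚ c +ₚ C a)

  eval-f : ∀ x → eval f x ≈ x ^ᴿ r * (x ^ᴿ c + a)
  eval-f x = begin
    eval f x                                        ≈⟨ eval-*ₚ (X ^ₚ r) (X ^ₚ c +ₚ C a) x ⟩
    eval (X ^ₚ r) x * eval (X ^ₚ c +ₚ C a) x        ≈⟨ *-cong (eval-X^ r x) (eval-+ₚ (X ^ₚ c) (C a) x) ⟩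
    x ^ᴿ r * (eval (X ^ₚ c) x + eval (C a) x)       ≈⟨ *-congˡ (+-cong (eval-X^ c x) (eval-C a x)) ⟩
    x ^ᴿ r * (x ^ᴿ c + a)                           ∎

  eval-f′ : ∀ x → eval f x ≈ x ^ᴿ (r +ℕ c) + a * x ^ᴿ r
  eval-f′ x = begin
    eval f x                              ≈⟨ eval-f x ⟩
    x ^ᴿ r * (x ^ᴿ c + a)                 ≈⟨ distribˡ (x ^ᴿ r) (x ^ᴿ c) a ⟩
    x ^ᴿ r * x ^ᴿ c + x ^ᴿ r * a          ≈⟨ +-cong (^-homo-* x r c) (*-comm a (x ^ᴿ r)) ⟨
    x ^ᴿ (r +ℕ c) + a * x ^ᴿ r            ∎

  0^ : ∀ {x} k → 1 ≤ k → x ≈ 0# → x ^ᴿ k ≈ 0#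
  0^ (suc k) _ x≈0 = trans (*-congʳ x≈0) (zeroˡ _)

  f[0]≈0 : ∀ {x} → x ≈ 0# → eval f x ≈ 0#
  f[0]≈0 {x} x≈0 = trans (eval-f x) (trans (*-congʳ (0^ r 1≤r x≈0)) (zeroˡ _))

  shift≋[] : ∀ k {p} → shift k p ≋ [] → p ≋ []
  shift≋[] zero    p≋[] = p≋[]
  shift≋[] (suc k) p≋[] = shift≋[] k (≋[]-tail p≋[])

  C1≄[] : ¬ C 1# ≋ []
  C1≄[] C1≋[] = 1≉0 (coeff-≈ C1≋[] 0)

  -- Conditions forced by injectivity of f

  -- geometricSum b j is ∑ᵢ≤ⱼ bʲ⁻ⁱ Xᶜⁱ, the cofactor of Xᶜ - b in Xᶜ⁽ʲ⁺¹⁾ - bʲ⁺¹.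
  geometricSum : Carrier → ℕ → Poly
  geometricSum b zero    = C 1#
  geometricSum b (suc j) = b ^ᴿ suc j ∷ shift (pred c) (geometricSum b j)

  length-geometricSum : ∀ b j → length (geometricSum b j) ≡ suc (j *ℕ c)
  length-geometricSum b zero    = ≡.refl
  length-geometricSum b (suc j) = cong suc (≡.trans (length-shift (pred c) (geometricSum b j))
    (≡.trans (cong (pred c +ℕ_) (length-geometricSum b j))
    (≡.trans (ℕ.+-suc (pred c) (j *ℕ c)) (cong (_+ℕ j *ℕ c) (ℕ.suc-pred c)))))

  geometricSum≄[] : ∀ b j → ¬ geometricSum b j ≋ []
  geometricSum≄[] b zero    = C1≄[]
  geometricSum≄[] b (suc j) eq = geometricSum≄[] b j (shift≋[] (pred c) (≋[]-tail eq))

  -- This is (y - b) G = y^(j+1) - b^(j+1) with the negative terms moved across. The induction rests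
  -- on G for j + 1 being b^(j+1) + yG.
  eval-geometricSum : ∀ b j x → let y = x ^ᴿ c ; G = eval (geometricSum b j) x in
                      y * G + b ^ᴿ suc j ≈ b * G + y ^ᴿ suc j
  eval-geometricSum b zero x = trans (+-comm _ _)
    (+-cong (*-congˡ (sym (eval-C 1# x))) (*-congˡ (eval-C 1# x)))
  eval-geometricSum b (suc j) x = begin
    y * G′ + b * B                    ≈⟨ +-congʳ (trans (*-congˡ G′≈) (distribˡ y B (y * G))) ⟩
    (y * B + y * (y * G)) + b * B     ≈⟨ +-congʳ (trans (+-comm _ _) (sym (distribˡ y (y * G) B))) ⟩
    y * (y * G + B) + b * B           ≈⟨ +-congʳ (*-congˡ (eval-geometricSum b j x)) ⟩
    y * (b * G + Y) + b * B           ≈⟨ +-congʳ (trans (distribˡ y (b * G) Y) (+-congʳ (x∙yz≈y∙xz y b G))) ⟩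
    (b * (y * G) + y * Y) + b * B     ≈⟨ trans (+-comm _ _) (sym (+-assoc _ _ _)) ⟩
    (b * B + b * (y * G)) + y * Y     ≈⟨ +-congʳ (trans (*-congˡ G′≈) (distribˡ b B (y * G))) ⟨
    b * G′ + y * Y                    ∎
    where
    y = x ^ᴿ c
    G = eval (geometricSum b j) x
    G′ = eval (geometricSum b (suc j)) x
    B = b ^ᴿ suc j
    Y = y ^ᴿ suc j
    G′≈ : G′ ≈ B + y * G
    G′≈ = +-congˡ (begin
      x * eval (shift (pred c) (geometricSum b j)) x   ≈⟨ *-congˡ (eval-shift (pred c) (geometricSum b j) x) ⟩
      x * (x ^ᴿ pred c * G)                            ≈⟨ *-assoc x _ G ⟨
      x ^ᴿ suc (pred c) * G                            ≡⟨ cong (λ k → x ^ᴿ k * G) (ℕ.suc-pred c) ⟩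
      y * G                                            ∎)

  -- If (-a)^ℓ = 1, then x^(q-1) + a is a factor of x^(q^e-1) - 1, hence vanishes somewhere outside 0.
  injective⇒norm≉1 : Injective _≈_ _≈_ (eval f) → ((- a) ^ᴿ ℓ) ≉ 1#
  injective⇒norm≉1 f-injective norm≈1 =
      geometricSum≄[] b j (vanishing⇒zero card (geometricSum b j) length≤N vanishes)
    where
    b = - a
    j = pred ℓ
    length≤N : length (geometricSum b j) ≤ N
    length≤N = ℕ.≤-trans (ℕ.≤-reflexive (length-geometricSum b j))
      (ℕ.≤-trans (ℕ.+-monoˡ-≤ (j *ℕ c) (>-nonZero⁻¹ c))
        (ℕ.≤-reflexive (≡.trans (cong (_*ℕ c) (ℕ.suc-pred ℓ)) (ℕ.*-comm ℓ c))))
    x^c≉b : ∀ x → x ≉ 0# → x ^ᴿ c ≉ b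
    x^c≉b x x≉0 x^c≈b = x≉0 (f-injective (trans (trans (eval-f x)
      (trans (*-congˡ (trans (+-congʳ x^c≈b) (-‿inverseˡ a))) (zeroʳ _))) (sym (f[0]≈0 refl))))
    -- Were the cofactor G nonzero at x, cancelling it would give x^c = b, which injectivity
    -- excludes. So G, of length at most `N` and not zero, would have all nonzero elements as roots.
    vanishes : ∀ x → x ≉ 0# → eval (geometricSum b j) x ≈ 0#
    vanishes x x≉0 with _≟_ card (eval (geometricSum b j) x) 0#
    ... | yes G≈0 = G≈0
    ... | no  G≉0 = contradiction
        (*-cancelˡ card G≉0 (trans (*-comm _ _) (trans (+-cancelʳ 1# _ _ yG+1≈bG+1) (*-comm _ _))))
        (x^c≉b x x≉0)
      where
      y = x ^ᴿ c
      G = eval (geometricSum b j) x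
      y^ℓ≈1 : y ^ᴿ suc j ≈ 1#
      y^ℓ≈1 = begin
        y ^ᴿ suc j     ≡⟨ cong (y ^ᴿ_) (ℕ.suc-pred ℓ) ⟩
        y ^ᴿ ℓ         ≈⟨ ^-assocʳ x c ℓ ⟩
        x ^ᴿ N         ≈⟨ fermat card 1≉0 x≉0 ⟩
        1#             ∎
      b^ℓ≈1 : b ^ᴿ suc j ≈ 1#
      b^ℓ≈1 = trans (reflexive (cong (b ^ᴿ_) (ℕ.suc-pred ℓ))) norm≈1
      yG+1≈bG+1 : y * G + 1# ≈ b * G + 1#
      yG+1≈bG+1 = begin
        y * G + 1#            ≈⟨ +-congˡ b^ℓ≈1 ⟨
        y * G + b ^ᴿ suc j    ≈⟨ eval-geometricSum b j x ⟩
        b * G + y ^ᴿ suc j    ≈⟨ +-congˡ y^ℓ≈1 ⟩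
        b * G + 1#            ∎

  -- With d = gcd(r, q-1), every d-th root of unity ζ satisfies f(ζ) = f(1).
  injective⇒coprime : Injective _≈_ _≈_ (eval f) → gcd r c ≡ 1
  injective⇒coprime f-injective = d≡1 (gcd r c) (gcd[m,n]∣m r c) (gcd[m,n]∣n r c)
    where
    rootOfUnity : ∀ {d k ζ} → d ∣ k → ζ ^ᴿ d ≈ 1# → ζ ^ᴿ k ≈ 1#
    rootOfUnity {d} {ζ = ζ} (divides w ≡.refl) ζ^d≈1 = begin
      ζ ^ᴿ (w *ℕ d)    ≡⟨ cong (ζ ^ᴿ_) (ℕ.*-comm w d) ⟩
      ζ ^ᴿ (d *ℕ w)    ≈⟨ ^-assocʳ ζ d w ⟨
      (ζ ^ᴿ d) ^ᴿ w    ≈⟨ ^ᴿ-cong w ζ^d≈1 ⟩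
      1# ^ᴿ w          ≈⟨ ^ᴿ-1 card 1≉0 w ⟩
      1#               ∎
    f[ζ]≈1+a : ∀ {d ζ} → d ∣ r → d ∣ c → ζ ^ᴿ d ≈ 1# → eval f ζ ≈ 1# * (1# + a)
    f[ζ]≈1+a {ζ = ζ} d∣r d∣c ζ^d≈1 = trans (eval-f ζ)
      (*-cong (rootOfUnity d∣r ζ^d≈1) (+-congʳ (rootOfUnity d∣c ζ^d≈1)))
    ζ≈1 : ∀ {d ζ} → d ∣ r → d ∣ c → ζ ^ᴿ d ≈ 1# → ζ ≈ 1#
    ζ≈1 {d} d∣r d∣c ζ^d≈1 = f-injective
      (trans (f[ζ]≈1+a d∣r d∣c ζ^d≈1) (sym (f[ζ]≈1+a d∣r d∣c (^ᴿ-1 card 1≉0 d))))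
    d≡1 : ∀ d → d ∣ r → d ∣ c → d ≡ 1
    d≡1 zero       d∣r d∣c = contradiction (∣.0∣⇒≡0 d∣c) (≢-nonZero⁻¹ c)
    d≡1 (suc zero) d∣r d∣c = ≡.refl
    d≡1 d@(suc (suc _)) d∣r d∣c with ∣.∣-trans d∣c (∣.m∣m*n {c} ℓ)
    ... | divides zero N≡0 = contradiction N≡0 (≢-nonZero⁻¹ N)
    ... | divides m@(suc m-1) N≡md = contradiction (vanishing⇒zero card p length≤N vanishes) p≄[]
      where
      -- This is X^m - 1 with m = N/d. Each x^m is a d-th root of unity, hence 1 by injectivity, so
      -- for d ≥ 2 there are more roots than the degree m allows.
      p : Poly
      p = - 1# ∷ shift m-1 (C 1#)
      p≄[] : ¬ p ≋ []
      p≄[] p≋[] = C1≄[] (shift≋[] m-1 (≋[]-tail p≋[]))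
      length≤N : length p ≤ N
      length≤N = ℕ.≤-trans
        (ℕ.≤-reflexive (cong suc (≡.trans (length-shift m-1 (C 1#)) (ℕ.+-comm m-1 1))))
        (ℕ.≤-trans (ℕ.m<m*n m d (s≤s (s≤s z≤n))) (ℕ.≤-reflexive (≡.sym N≡md)))
      vanishes : ∀ x → x ≉ 0# → eval p x ≈ 0#
      vanishes x x≉0 = begin
        - 1# + x * eval (shift m-1 (C 1#)) x    ≈⟨ +-congˡ (*-congˡ (trans (eval-shift m-1 (C 1#) x) (*-congˡ (eval-C 1# x)))) ⟩
        - 1# + x * (x ^ᴿ m-1 * 1#)              ≈⟨ +-congˡ (*-congˡ (*-identityʳ _)) ⟩
        - 1# + x ^ᴿ m                           ≈⟨ +-congˡ (ζ≈1 d∣r d∣c (begin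
            (x ^ᴿ m) ^ᴿ d   ≈⟨ ^-assocʳ x m d ⟩
            x ^ᴿ (m *ℕ d)   ≡⟨ cong (x ^ᴿ_) N≡md ⟨
            x ^ᴿ N          ≈⟨ fermat card 1≉0 x≉0 ⟩
            1#              ∎)) ⟩
        - 1# + 1#                               ≈⟨ -‿inverseˡ 1# ⟩
        0#                                      ∎

  -- Comparison of exponents in f = L(x^n)

  %-∼ : ∀ {i j} → i % N ≡ j % N → i ∼ j [ N ]
  %-∼ {i} {j} eq = ∼-trans (reduce i) (∼-trans (∼-reflexive eq) (∼-sym (reduce j)))
    where
    reduce : ∀ i → i ∼ i % N [ N ]
    reduce i = congruent 0 (i / N) (≡.trans (ℕ.+-identityʳ i) (m≡m%n+[m/n]*n i N))

  length-+ₚ : ∀ p p′ → length (p +ₚ p′) ≡ length p ⊔ length p′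
  length-+ₚ []      p′       = ≡.refl
  length-+ₚ (_ ∷ p) []       = ≡.refl
  length-+ₚ (_ ∷ p) (_ ∷ p′) = cong suc (length-+ₚ p p′)

  -- With exponents reduced modulo `N`, the difference of the two sides is a list of length at most
  -- `N` vanishing on all nonzero elements, so its coefficients are 0. The coefficients 1 and a sit
  -- at different places, and each can only be cancelled by a term from the right; the two cannot
  -- share an exponent there, as `i` and `j` would then agree.
  binomials-agree : ∀ {i j k l} u v → ¬ i ∼ j [ N ] →
    (∀ x → x ≉ 0# → x ^ᴿ i + a * x ^ᴿ j ≈ u * x ^ᴿ k + v * x ^ᴿ l) →
    (i ∼ k [ N ] × j ∼ l [ N ]) ⊎ (i ∼ l [ N ] × j ∼ k [ N ])
  binomials-agree {i} {j} {k} {l} u v i≁j agree = combine matchᵢ matchⱼ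
    where
    mono : Carrier → ℕ → Poly
    mono w i = shift (i % N) (C w)
    p : Poly
    p = (mono 1# i +ₚ mono a j) +ₚ (mono (- u) k +ₚ mono (- v) l)
    length-mono : ∀ w i → length (mono w i) ≤ N
    length-mono w i = ℕ.≤-trans (ℕ.≤-reflexive (≡.trans (length-shift (i % N) (C w)) (ℕ.+-comm (i % N) 1))) (m%n<n i N)
    length-sum : ∀ p p′ → length p ≤ N → length p′ ≤ N → length (p +ₚ p′) ≤ N
    length-sum p p′ ∣p∣≤N ∣p′∣≤N = ℕ.≤-trans (ℕ.≤-reflexive (length-+ₚ p p′)) (ℕ.⊔-lub ∣p∣≤N ∣p′∣≤N)
    eval-mono : ∀ w i x → x ≉ 0# → eval (mono w i) x ≈ w * x ^ᴿ i
    eval-mono w i x x≉0 = begin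
      eval (shift (i % N) (C w)) x     ≈⟨ eval-shift (i % N) (C w) x ⟩
      x ^ᴿ (i % N) * eval (C w) x      ≈⟨ *-cong (^ᴿ-∼ card 1≉0 x≉0 (%-∼ (m%n%n≡m%n i N))) (eval-C w x) ⟩
      x ^ᴿ i * w                       ≈⟨ *-comm _ w ⟩
      w * x ^ᴿ i                       ∎
    vanishes : ∀ x → x ≉ 0# → eval p x ≈ 0#
    vanishes x x≉0 = begin
      eval p x
        ≈⟨ eval-+ₚ (mono 1# i +ₚ mono a j) _ x ⟩
      eval (mono 1# i +ₚ mono a j) x + eval (mono (- u) k +ₚ mono (- v) l) x
        ≈⟨ +-cong (eval-+ₚ (mono 1# i) _ x) (eval-+ₚ (mono (- u) k) _ x) ⟩
      (eval (mono 1# i) x + eval (mono a j) x) + (eval (mono (- u) k) x + eval (mono (- v) l) x)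
        ≈⟨ +-cong (+-cong (trans (eval-mono 1# i x x≉0) (*-identityˡ _)) (eval-mono a j x x≉0))
                  (+-cong (trans (eval-mono (- u) k x x≉0) (sym (-‿distribˡ-* u _)))
                          (trans (eval-mono (- v) l x x≉0) (sym (-‿distribˡ-* v _)))) ⟩
      (x ^ᴿ i + a * x ^ᴿ j) + (- (u * x ^ᴿ k) + - (v * x ^ᴿ l))
        ≈⟨ +-cong (agree x x≉0) (-‿+-comm _ _) ⟩
      (u * x ^ᴿ k + v * x ^ᴿ l) - (u * x ^ᴿ k + v * x ^ᴿ l)
        ≈⟨ -‿inverseʳ _ ⟩
      0# ∎
    p≋[] : p ≋ []
    p≋[] = vanishing⇒zero card p
      (length-sum (mono 1# i +ₚ mono a j) (mono (- u) k +ₚ mono (- v) l)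
        (length-sum (mono 1# i) (mono a j) (length-mono 1# i) (length-mono a j))
        (length-sum (mono (- u) k) (mono (- v) l) (length-mono (- u) k) (length-mono (- v) l)))
      vanishes
    coeff-p : ∀ n → (coeff (mono 1# i) n + coeff (mono a j) n) + (coeff (mono (- u) k) n + coeff (mono (- v) l) n) ≈ 0#
    coeff-p n = begin
      (coeff (mono 1# i) n + coeff (mono a j) n) + (coeff (mono (- u) k) n + coeff (mono (- v) l) n)
        ≈⟨ +-cong (coeff-+ₚ (mono 1# i) _ n) (coeff-+ₚ (mono (- u) k) _ n) ⟨
      coeff (mono 1# i +ₚ mono a j) n + coeff (mono (- u) k +ₚ mono (- v) l) n
        ≈⟨ coeff-+ₚ (mono 1# i +ₚ mono a j) _ n ⟨
      coeff p n
        ≈⟨ coeff-≈ p≋[] n ⟩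
      0# ∎
    i%≢j% : i % N ≢ j % N
    i%≢j% eq = i≁j (%-∼ eq)
    other : ∀ w k n → n ≢ k % N → coeff (mono w k) n ≈ 0#
    other w k n n≢k = coeff-shift-≢ (k % N) w n n≢k
    matchᵢ : i ∼ k [ N ] ⊎ i ∼ l [ N ]
    matchᵢ with i % N ℕ.≟ k % N | i % N ℕ.≟ l % N
    ... | yes i≡k | _       = inj₁ (%-∼ i≡k)
    ... | no  _   | yes i≡l = inj₂ (%-∼ i≡l)
    ... | no  i≢k | no  i≢l = contradiction (begin
      1#                       ≈⟨ +-identityʳ 1# ⟨
      1# + 0#                  ≈⟨ +-cong (+-identityʳ 1#) (+-identityʳ 0#) ⟨
      (1# + 0#) + (0# + 0#)    ≈⟨ +-cong (+-cong (coeff-shift (i % N) 1#) (other a j (i % N) i%≢j%))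
                                         (+-cong (other (- u) k (i % N) i≢k) (other (- v) l (i % N) i≢l)) ⟨
      _                        ≈⟨ coeff-p (i % N) ⟩
      0#                       ∎) 1≉0
    matchⱼ : j ∼ k [ N ] ⊎ j ∼ l [ N ]
    matchⱼ with j % N ℕ.≟ k % N | j % N ℕ.≟ l % N
    ... | yes j≡k | _       = inj₁ (%-∼ j≡k)
    ... | no  _   | yes j≡l = inj₂ (%-∼ j≡l)
    ... | no  j≢k | no  j≢l = contradiction (begin
      a                        ≈⟨ +-identityʳ a ⟨
      a + 0#                   ≈⟨ +-cong (+-identityˡ a) (+-identityʳ 0#) ⟨
      (0# + a) + (0# + 0#)     ≈⟨ +-cong (+-cong (other 1# i (j % N) (λ eq → i%≢j% (≡.sym eq))) (coeff-shift (j % N) a))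
                                         (+-cong (other (- u) k (j % N) j≢k) (other (- v) l (j % N) j≢l)) ⟨
      _                        ≈⟨ coeff-p (j % N) ⟩
      0#                       ∎) a≉0
    combine : i ∼ k [ N ] ⊎ i ∼ l [ N ] → j ∼ k [ N ] ⊎ j ∼ l [ N ] →
              (i ∼ k [ N ] × j ∼ l [ N ]) ⊎ (i ∼ l [ N ] × j ∼ k [ N ])
    combine (inj₁ i∼k) (inj₂ j∼l) = inj₁ (i∼k , j∼l)
    combine (inj₂ i∼l) (inj₁ j∼k) = inj₂ (i∼l , j∼k)
    combine (inj₁ i∼k) (inj₁ j∼k) = contradiction (∼-trans i∼k (∼-sym j∼k)) i≁j
    combine (inj₂ i∼l) (inj₂ j∼l) = contradiction (∼-trans i∼l (∼-sym j∼l)) i≁j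

  -- The exponents r + c and r match n q^m and n q^m′ in one of the two orders, and `shift-exponent`
  -- removes n in either case.
  composition⇒exponent : LinearizedBinomial∘Monomial q e f →
                         ∃[ h ] 1 ≤ h × r *ℕ q ^ h ∼ r +ℕ c [ N ]
  composition⇒exponent (L , n , (m , m′ , b , d , _ , _ , _ , L≈) , record { quotient = g ; equality = gM≈f-L∘X^n }) = exponent
    (binomials-agree b d r+c≁r λ x x≉0 → begin
      x ^ᴿ (r +ℕ c) + a * x ^ᴿ r                                ≈⟨ eval-f′ x ⟨
      eval f x                                                  ≈⟨ f[x]≈ x x≉0 ⟩
      eval (L ∘ₚ (X ^ₚ n)) x                                    ≈⟨ eval-∘ₚ L (X ^ₚ n) x ⟩
      eval L (eval (X ^ₚ n) x)                                  ≈⟨ eval-L (eval (X ^ₚ n) x) ⟩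
      b * eval (X ^ₚ n) x ^ᴿ (q ^ m) + d * eval (X ^ₚ n) x ^ᴿ (q ^ m′)
        ≈⟨ +-cong (*-congˡ (power x (q ^ m))) (*-congˡ (power x (q ^ m′))) ⟩
      b * x ^ᴿ (n *ℕ q ^ m) + d * x ^ᴿ (n *ℕ q ^ m′)            ∎)
    where
    1≤h : ∀ i j → 1 ≤ e +ℕ j +ℕ i *ℕ pred e
    1≤h i j = ℕ.≤-trans (ℕ.<⇒≤ 2≤e) (ℕ.≤-trans (ℕ.m≤m+n e j) (ℕ.m≤m+n (e +ℕ j) _))
    exponent : (r +ℕ c ∼ n *ℕ q ^ m [ N ] × r ∼ n *ℕ q ^ m′ [ N ]) ⊎ (r +ℕ c ∼ n *ℕ q ^ m′ [ N ] × r ∼ n *ℕ q ^ m [ N ]) →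
               ∃[ h ] 1 ≤ h × r *ℕ q ^ h ∼ r +ℕ c [ N ]
    exponent (inj₁ (r+c∼ , r∼)) = _ , 1≤h m′ m , shift-exponent r n m′ m r∼ r+c∼
    exponent (inj₂ (r+c∼ , r∼)) = _ , 1≤h m m′ , shift-exponent r n m m′ r∼ r+c∼
    -- Otherwise `N` would divide `c`, yet `N` is `c` times a factor greater than 1.
    r+c≁r : ¬ r +ℕ c ∼ r [ N ]
    r+c≁r r+c∼r = ℕ.<⇒≱ (ℕ.m<m*n c ℓ (1<ℓ 2≤e))
      (∣.∣⇒≤ (∼0⇒∣ (∼-+-cancelˡ r (∼-trans r+c∼r (∼-reflexive (≡.sym (ℕ.+-identityʳ r)))))))
    power : ∀ x k → eval (X ^ₚ n) x ^ᴿ k ≈ x ^ᴿ (n *ℕ k)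
    power x k = trans (^ᴿ-cong k (eval-X^ n x)) (^-assocʳ x n k)
    eval-term : ∀ w k y → eval (C w *ₚ X ^ₚ k) y ≈ w * y ^ᴿ k
    eval-term w k y = trans (eval-*ₚ (C w) (X ^ₚ k) y) (*-cong (eval-C w y) (eval-X^ k y))
    eval-L : ∀ y → eval L y ≈ b * y ^ᴿ (q ^ m) + d * y ^ᴿ (q ^ m′)
    eval-L y = begin
      eval L y                                                       ≈⟨ eval-cong L (C b *ₚ X ^ₚ (q ^ m) +ₚ C d *ₚ X ^ₚ (q ^ m′)) y (coefficientwise L≈) ⟩
      eval (C b *ₚ X ^ₚ (q ^ m) +ₚ C d *ₚ X ^ₚ (q ^ m′)) y           ≈⟨ eval-+ₚ (C b *ₚ X ^ₚ (q ^ m)) _ y ⟩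
      eval (C b *ₚ X ^ₚ (q ^ m)) y + eval (C d *ₚ X ^ₚ (q ^ m′)) y   ≈⟨ +-cong (eval-term b (q ^ m) y) (eval-term d (q ^ m′) y) ⟩
      b * y ^ᴿ (q ^ m) + d * y ^ᴿ (q ^ m′)                           ∎
    M : Poly
    M = X ^ₚ (q ^ e) -ₚ X
    M[x]≈0 : ∀ x → x ≉ 0# → eval M x ≈ 0#
    M[x]≈0 x x≉0 = begin
      eval M x                               ≈⟨ eval-+ₚ (X ^ₚ (q ^ e)) (-ₚ X) x ⟩
      eval (X ^ₚ (q ^ e)) x + eval (-ₚ X) x  ≈⟨ +-cong (eval-X^ (q ^ e) x) (trans (eval--ₚ X x) (-‿cong (eval-X x))) ⟩
      x ^ᴿ (q ^ e) - x                       ≈⟨ +-congʳ (trans (^ᴿ-∼ card 1≉0 x≉0 q^e∼1) (*-identityʳ x)) ⟩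
      x - x                                  ≈⟨ -‿inverseʳ x ⟩
      0#                                     ∎
    f[x]≈ : ∀ x → x ≉ 0# → eval f x ≈ eval (L ∘ₚ (X ^ₚ n)) x
    f[x]≈ x x≉0 = x∙y⁻¹≈ε⇒x≈y _ _ (begin
      eval f x - eval (L ∘ₚ (X ^ₚ n)) x           ≈⟨ +-congˡ (eval--ₚ (L ∘ₚ (X ^ₚ n)) x) ⟨
      eval f x + eval (-ₚ (L ∘ₚ (X ^ₚ n))) x      ≈⟨ eval-+ₚ f _ x ⟨
      eval (f -ₚ L ∘ₚ (X ^ₚ n)) x                 ≈⟨ eval-cong (g *ₚ M) (f -ₚ L ∘ₚ (X ^ₚ n)) x (coefficientwise gM≈f-L∘X^n) ⟨
      eval (g *ₚ M) x                             ≈⟨ eval-*ₚ g M x ⟩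
      eval g x * eval M x                         ≈⟨ *-congˡ (M[x]≈0 x x≉0) ⟩
      eval g x * 0#                               ≈⟨ zeroʳ _ ⟩
      0#                                          ∎)

  -- From the exponent congruence back to f

  -- A Bézout relation ui = 1 + vj recovers a nonzero z as z^(ui) / z^(vj), so two powers with
  -- coprime exponents determine it.
  ^-≈-coprime : ∀ {x y} → x ≉ 0# → ∀ i j u v → 1 +ℕ v *ℕ j ≡ u *ℕ i →
                x ^ᴿ i ≈ y ^ᴿ i → x ^ᴿ j ≈ y ^ᴿ j → x ≈ y
  ^-≈-coprime {x} {y} x≉0 i j u v eq x^i≈y^i x^j≈y^j = *-cancelˡ card (^-≉0 card 1≉0 (j *ℕ v) x≉0) (begin
      x ^ᴿ (j *ℕ v) * x       ≈⟨ split x ⟩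
      (x ^ᴿ i) ^ᴿ u           ≈⟨ ^ᴿ-cong u x^i≈y^i ⟩
      (y ^ᴿ i) ^ᴿ u           ≈⟨ split y ⟨
      y ^ᴿ (j *ℕ v) * y       ≈⟨ *-congʳ (trans (sym (^-assocʳ x j v)) (trans (^ᴿ-cong v x^j≈y^j) (^-assocʳ y j v))) ⟨
      x ^ᴿ (j *ℕ v) * y       ∎)
    where
    split : ∀ z → z ^ᴿ (j *ℕ v) * z ≈ (z ^ᴿ i) ^ᴿ u
    split z = begin
      z ^ᴿ (j *ℕ v) * z       ≈⟨ *-comm _ z ⟩
      z ^ᴿ suc (j *ℕ v)       ≡⟨ cong (z ^ᴿ_) (≡.trans (cong suc (ℕ.*-comm j v)) (≡.trans eq (ℕ.*-comm u i))) ⟩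
      z ^ᴿ (i *ℕ u)           ≈⟨ ^-assocʳ z i u ⟨
      (z ^ᴿ i) ^ᴿ u           ∎

  module _ {h : ℕ} (1≤h : 1 ≤ h) (exponent : r *ℕ q ^ h ∼ r +ℕ c [ N ]) where

    x^[r+c] : ∀ {x} → x ≉ 0# → x ^ᴿ (r +ℕ c) ≈ (x ^ᴿ r) ^ᴿ (q ^ h)
    x^[r+c] {x} x≉0 = trans (^ᴿ-∼ card 1≉0 x≉0 (∼-sym exponent)) (sym (^-assocʳ x r (q ^ h)))

    L : Carrier → Carrier
    L u = u ^ᴿ (q ^ h) + a * u

    L[0]≈0 : ∀ {u} → u ≈ 0# → L u ≈ 0#
    L[0]≈0 u≈0 = trans (+-cong (0^ (q ^ h) (ℕ.m^n>0 q h) u≈0) (trans (*-congˡ u≈0) (zeroʳ a))) (+-identityʳ 0#)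

    f[x]≈L[x^r] : ∀ x → eval f x ≈ L (x ^ᴿ r)
    f[x]≈L[x^r] x with _≟_ card x 0#
    ... | yes x≈0 = trans (f[0]≈0 x≈0) (sym (L[0]≈0 (0^ r 1≤r x≈0)))
    ... | no  x≉0 = trans (eval-f′ x) (+-congʳ (x^[r+c] x≉0))

    x^r-injective : gcd r c ≡ 1 → ∀ {x y} → x ^ᴿ r ≈ y ^ᴿ r → x ≈ y
    x^r-injective gcd≡1 {x} {y} x^r≈y^r with _≟_ card x 0# | _≟_ card y 0#
    ... | yes x≈0 | yes y≈0 = trans x≈0 (sym y≈0)
    ... | yes x≈0 | no  y≉0 = contradiction (trans (sym x^r≈y^r) (0^ r 1≤r x≈0)) (^-≉0 card 1≉0 r y≉0)
    ... | no  x≉0 | yes y≈0 = contradiction (trans x^r≈y^r (0^ r 1≤r y≈0)) (^-≉0 card 1≉0 r x≉0)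
    ... | no  x≉0 | no  y≉0 = bézout (coprime-Bézout (gcd≡1⇒coprime {r} {c} gcd≡1))
      where
      x^c≈y^c : x ^ᴿ c ≈ y ^ᴿ c
      x^c≈y^c = *-cancelˡ card (^-≉0 card 1≉0 r x≉0) (begin
        x ^ᴿ r * x ^ᴿ c        ≈⟨ ^-homo-* x r c ⟨
        x ^ᴿ (r +ℕ c)          ≈⟨ x^[r+c] x≉0 ⟩
        (x ^ᴿ r) ^ᴿ (q ^ h)    ≈⟨ ^ᴿ-cong (q ^ h) x^r≈y^r ⟩
        (y ^ᴿ r) ^ᴿ (q ^ h)    ≈⟨ x^[r+c] y≉0 ⟨
        y ^ᴿ (r +ℕ c)          ≈⟨ ^-homo-* y r c ⟩
        y ^ᴿ r * y ^ᴿ c        ≈⟨ *-congʳ x^r≈y^r ⟨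
        x ^ᴿ r * y ^ᴿ c        ∎)
      bézout : Bézout.Identity 1 r c → x ≈ y
      bézout (Bézout.+- u v eq) = ^-≈-coprime x≉0 r c u v eq x^r≈y^r x^c≈y^c
      bézout (Bézout.-+ u v eq) = ^-≈-coprime x≉0 c r v u eq x^c≈y^c x^r≈y^r

    L-kernel : ((- a) ^ᴿ ℓ) ≉ 1# → ∀ w → L w ≈ 0# → w ≈ 0#
    L-kernel norm≉1 w L[w]≈0 with _≟_ card w 0#
    ... | yes w≈0 = w≈0
    ... | no  w≉0 = contradiction (begin
        (- a) ^ᴿ ℓ              ≈⟨ ^ᴿ-cong ℓ w^cν≈-a ⟨
        (w ^ᴿ (c *ℕ ν)) ^ᴿ ℓ    ≈⟨ ^-assocʳ w (c *ℕ ν) ℓ ⟩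
        w ^ᴿ (c *ℕ ν *ℕ ℓ)      ≈⟨ ^ᴿ-∼ card 1≉0 w≉0 cνℓ∼0 ⟩
        1#                      ∎) norm≉1
      where
      -- The geometric sum with h in place of e, so that q^h - 1 = cν; raising to the power `ℓ` then
      -- produces the exponent νN.
      ν : ℕ
      ν = Exponents.ℓ c h
      cνℓ∼0 : c *ℕ ν *ℕ ℓ ∼ 0 [ N ]
      cνℓ∼0 = congruent 0 ν (≡.trans (ℕ.+-identityʳ _)
        (≡.trans (cong (_*ℕ ℓ) (ℕ.*-comm c ν)) (ℕ.*-assoc ν c ℓ)))
      w^cν≈-a : w ^ᴿ (c *ℕ ν) ≈ - a
      w^cν≈-a = *-cancelˡ card w≉0 (begin
        w ^ᴿ suc (c *ℕ ν)    ≡⟨ cong (w ^ᴿ_) (Exponents.q^e≡1+N c h) ⟨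
        w ^ᴿ (q ^ h)         ≈⟨ +-inverseˡ-unique _ _ L[w]≈0 ⟩
        - (a * w)            ≈⟨ -‿distribˡ-* a w ⟩
        - a * w              ≈⟨ *-comm (- a) w ⟩
        w * - a              ∎)

    exponent⇒permutes : ∀ {p} t → Prime p → q ≡ p ^ t → ((- a) ^ᴿ ℓ) ≉ 1# → gcd r c ≡ 1 → Permutes f
    exponent⇒permutes {p} t p-prime q≡p^t norm≉1 gcd≡1 = injective⇒bijective card f-cong λ {x} {y} f[x]≈f[y] →
        x^r-injective gcd≡1 (L-injective (trans (sym (f[x]≈L[x^r] x)) (trans f[x]≈f[y] (f[x]≈L[x^r] y))))
      where
      -- At h this makes u ↦ u^(q^h) an iterate of the p-th power map, hence additive; at e it
      -- identifies the number of elements as a power of p, which gives the characteristic.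
      p^[th]≡q^h : ∀ h → p ^ (t *ℕ h) ≡ q ^ h
      p^[th]≡q^h h = ≡.trans (≡.sym (ℕ.^-*-assoc p t h)) (cong (_^ h) (≡.sym q≡p^t))
      open Frobenius p-prime (characteristic card 1≉0 p (t *ℕ e) (≡.trans (p^[th]≡q^h e) q^e≡1+N))
      f-cong : ∀ {x y} → x ≈ y → eval f x ≈ eval f y
      f-cong {x} {y} x≈y = trans (eval-f x) (trans (*-cong (^ᴿ-cong r x≈y) (+-congʳ (^ᴿ-cong c x≈y))) (sym (eval-f y)))
      L-cong : ∀ {u v} → u ≈ v → L u ≈ L v
      L-cong u≈v = +-cong (^ᴿ-cong (q ^ h) u≈v) (*-congˡ u≈v)
      L-+ : ∀ u v → L (u + v) ≈ L u + L v
      L-+ u v = begin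
        (u + v) ^ᴿ (q ^ h) + a * (u + v)                         ≈⟨ +-cong ^q^h-+ (distribˡ a u v) ⟩
        (u ^ᴿ (q ^ h) + v ^ᴿ (q ^ h)) + (a * u + a * v)          ≈⟨ +-interchange _ _ _ _ ⟩
        L u + L v                                                ∎
        where
        ^q^h-+ : (u + v) ^ᴿ (q ^ h) ≈ u ^ᴿ (q ^ h) + v ^ᴿ (q ^ h)
        ^q^h-+ = subst (λ k → (u + v) ^ᴿ k ≈ u ^ᴿ k + v ^ᴿ k) (p^[th]≡q^h h) (^p^j-+ (t *ℕ h) u v)
      L-injective : ∀ {u v} → L u ≈ L v → u ≈ v
      L-injective {u} {v} L[u]≈L[v] = x∙y⁻¹≈ε⇒x≈y u v (L-kernel norm≉1 (u - v) (+-identityˡ-unique (L (u - v)) (L v) (begin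
        L (u - v) + L v      ≈⟨ L-+ (u - v) v ⟨
        L (u - v + v)        ≈⟨ L-cong (//-rightDividesˡ v u) ⟩
        L u                  ≈⟨ L[u]≈L[v] ⟩
        L v                  ∎)))

    -- The polynomials f and L(X^r) share the term aX^r and differ only in X^(r+c) against X^(r
    -- q^h). These two exponents are positive and congruent modulo `N`, so `X^-congruent` provides
    -- the quotient.
    exponent⇒composition : LinearizedBinomial∘Monomial q e f
    exponent⇒composition =
        Lₚ , r , (0 , h , a , 1# , ℕ.<⇒≢ 1≤h , a≉0 , 1≉0 , coeff-≈ Lₚ-binomial) ,
        subst (λ n → X ^ₚ n -ₚ X ∣ₚ f -ₚ Lₚ ∘ₚ (X ^ₚ r)) (≡.sym q^e≡1+N)
          (record { quotient = proj₁ multiple ; equality = coeff-≈ (≋-trans (proj₂ multiple) (≋-sym f-Lₚ∘X^r)) })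
      where
      module E = SetoidReasoning ≋-setoid
      mono : ℕ → Poly
      mono k = shift k (C 1#)
      k j : ℕ
      k = q ^ h ∸ 2
      j = pred (r +ℕ c)
      q^h≡2+k : q ^ h ≡ suc (suc k)
      q^h≡2+k = ≡.sym (ℕ.m+[n∸m]≡n (ℕ.≤-trans (s≤s (>-nonZero⁻¹ c)) q≤q^h))
        where
        q≤q^h : q ≤ q ^ h
        q≤q^h = ℕ.≤-trans (ℕ.≤-reflexive (≡.sym (ℕ.*-identityʳ q))) (ℕ.^-monoʳ-≤ q 1≤h)
      r+c≡1+j : r +ℕ c ≡ suc j
      r+c≡1+j = ≡.sym (ℕ.suc-pred (r +ℕ c) {{>-nonZero (ℕ.≤-trans 1≤r (ℕ.m≤m+n r c))}})
      -- As r ≥ 1, r + c ≤ r + rc = rq. This turns the two-sided congruence into r q^h = r + c + tN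
      -- with t natural, the one-sided form that `X^-congruent` takes.
      r+c≤r*q^h : r +ℕ c ≤ r *ℕ q ^ h
      r+c≤r*q^h = ℕ.≤-trans (ℕ.+-monoʳ-≤ r (ℕ.m≤n*m c r {{>-nonZero 1≤r}}))
        (ℕ.≤-trans (ℕ.≤-reflexive (≡.sym (ℕ.*-suc r c)))
        (ℕ.*-monoʳ-≤ r (ℕ.≤-trans (ℕ.≤-reflexive (≡.sym (ℕ.*-identityʳ q))) (ℕ.^-monoʳ-≤ q 1≤h))))
      excess : ∃[ t ] r *ℕ q ^ h ≡ suc j +ℕ t *ℕ N
      excess with ∼⇒≅ exponent
      ... | divides t eq = t , ≡.trans (≡.sym (ℕ.m+[n∸m]≡n r+c≤r*q^h))
        (cong₂ _+ℕ_ r+c≡1+j (≡.trans (≡.sym (ℕ.m≤n⇒∣n-m∣≡n∸m r+c≤r*q^h)) eq))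
      multiple : ∃[ g ] g *ₚ (X ^ₚ suc N -ₚ X) ≋ mono (r +ℕ c) -ₚ mono (r *ℕ q ^ h)
      multiple = subst₂ (λ u v → ∃[ g ] g *ₚ (X ^ₚ suc N -ₚ X) ≋ mono u -ₚ mono v)
        (≡.sym r+c≡1+j) (≡.sym (proj₂ excess)) (X^-congruent N j (proj₁ excess))
      -- The binomial aX + X^(q^h) as one list: behind the coefficients 0 and a, the exponent left
      -- over is k = q^h - 2, an exact difference because q^h ≥ 2.
      Lₚ : Poly
      Lₚ = 0# ∷ a ∷ mono k
      Lₚ-binomial : Lₚ ≋ C a *ₚ X ^ₚ 1 +ₚ C 1# *ₚ X ^ₚ (q ^ h)
      Lₚ-binomial = E.begin
        0# ∷ a ∷ mono k                                E.≈⟨ ∷-cong (+-identityʳ 0#) (∷-cong (+-identityʳ a) ≋-refl) ⟨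
        shift 1 (C a) +ₚ mono (suc (suc k))            E.≡⟨ cong (λ n → shift 1 (C a) +ₚ mono n) q^h≡2+k ⟨
        shift 1 (C a) +ₚ mono (q ^ h)                  E.≈⟨ +ₚ-cong (C-*ₚ-X^ a 1) (C-*ₚ-X^ 1# (q ^ h)) ⟨
        C a *ₚ X ^ₚ 1 +ₚ C 1# *ₚ X ^ₚ (q ^ h)          E.∎
      Lₚ∘X^r : Lₚ ∘ₚ (X ^ₚ r) ≋ shift r (C a) +ₚ mono (r *ℕ q ^ h)
      Lₚ∘X^r = E.begin
        Lₚ ∘ₚ (X ^ₚ r)                                        E.≈⟨ 0∷-∘ₚ-X^ (a ∷ mono k) r ⟩
        shift r (C a +ₚ X ^ₚ r *ₚ (mono k ∘ₚ (X ^ₚ r)))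
          E.≈⟨ shift-cong r (+ₚ-cong (≋-refl {C a}) (≋-trans (X^-*ₚ r (mono k ∘ₚ (X ^ₚ r)))
                 (shift-cong r (≋-trans (shift-∘ₚ-X^ k (C 1#) r) (shift-cong (k *ℕ r) (C-∘ₚ-X^ 1# r)))))) ⟩
        shift r (C a +ₚ shift r (mono (k *ℕ r)))              E.≈⟨ shift-+ₚ r (C a) _ ⟩
        shift r (C a) +ₚ shift r (shift r (mono (k *ℕ r)))    E.≡⟨ cong (shift r (C a) +ₚ_) (cong (shift r) (shift-shift r (k *ℕ r) (C 1#))) ⟩
        shift r (C a) +ₚ shift r (mono (r +ℕ k *ℕ r))         E.≡⟨ cong (shift r (C a) +ₚ_) (shift-shift r (r +ℕ k *ℕ r) (C 1#)) ⟩
        shift r (C a) +ₚ mono (suc (suc k) *ℕ r)              E.≡⟨ cong (λ n → shift r (C a) +ₚ mono n) (≡.trans (cong (_*ℕ r) (≡.sym q^h≡2+k)) (ℕ.*-comm (q ^ h) r)) ⟩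
        shift r (C a) +ₚ mono (r *ℕ q ^ h)                    E.∎
      f≋ : f ≋ mono (r +ℕ c) +ₚ shift r (C a)
      f≋ = E.begin
        X ^ₚ r *ₚ (X ^ₚ c +ₚ C a)         E.≈⟨ X^-*ₚ r (X ^ₚ c +ₚ C a) ⟩
        shift r (X ^ₚ c +ₚ C a)           E.≈⟨ shift-+ₚ r (X ^ₚ c) (C a) ⟩
        shift r (X ^ₚ c) +ₚ shift r (C a) E.≈⟨ +ₚ-cong (shift-cong r (X^-shift c)) (≋-refl {shift r (C a)}) ⟩
        shift r (mono c) +ₚ shift r (C a) E.≡⟨ cong (_+ₚ shift r (C a)) (shift-shift r c (C 1#)) ⟩
        mono (r +ℕ c) +ₚ shift r (C a)    E.∎
      f-Lₚ∘X^r : f -ₚ Lₚ ∘ₚ (X ^ₚ r) ≋ mono (r +ℕ c) -ₚ mono (r *ℕ q ^ h)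
      f-Lₚ∘X^r = ≋-trans (+ₚ-cong f≋ (-ₚ-cong Lₚ∘X^r)) (+ₚ-minus-cancel (mono (r +ℕ c)) (shift r (C a)) (mono (r *ℕ q ^ h)))

  forwards : Permutes f × LinearizedBinomial∘Monomial q e f → ((- a) ^ᴿ ℓ) ≉ 1# × Criterion r × gcd r c ≡ 1
  forwards (permutes , composition) =
    injective⇒norm≉1 (proj₁ permutes) ,
    exponent⇒criterion 2≤e (composition⇒exponent composition) ,
    injective⇒coprime (proj₁ permutes)

  backwards : ∀ {p} t → Prime p → q ≡ p ^ t →
              ((- a) ^ᴿ ℓ) ≉ 1# × Criterion r × gcd r c ≡ 1 → Permutes f × LinearizedBinomial∘Monomial q e f
  backwards t p-prime q≡p^t (norm≉1 , criterion , coprime) =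
    let h , 1≤h , rel = criterion⇒exponent criterion in
    exponent⇒permutes 1≤h rel t p-prime q≡p^t norm≉1 coprime , exponent⇒composition 1≤h rel

-- The equivalence for a prime power q

primePower⇒2≤ : ∀ {p t} → Prime p → 1 ≤ t → 2 ≤ p ^ t
primePower⇒2≤ {p} {suc t} p-prime (s≤s _) = ℕ.≤-trans (nonTrivial⇒n>1 p {{prime⇒nonTrivial p-prime}})
  (ℕ.m≤m*n p (p ^ t) {{ℕ.m^n≢0 p t {{prime⇒nonZero p-prime}}}})

theorem1p4 :
    ∀ {c ℓ₁ ℓ₂} (q e r : ℕ) → PrimePower q → 2 ≤ e → 1 ≤ r →
    (F : HeytingField c ℓ₁ ℓ₂) →
    let open CommutativeRing (fieldRing F)
        open Polynomials (fieldRing F)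
    in
    HasCardinality setoid (q ^ e) →
    (a : Carrier) → a ≉ 0# →
    let f = X ^ₚ r *ₚ (X ^ₚ (q ∸ 1) +ₚ C a)
        ℓ = sum (applyUpTo (λ i → q ^ i) e)
    in
    (Permutes f × LinearizedBinomial∘Monomial q e f)
      ⇔
    ( ((- a) ^ᴿ ℓ) ≉ 1#
    × (∃[ h ] ∃[ k ] ∃[ s ]
         1 ≤ h × gcd h e ≡ 1 ×
         1 ≤ k × h *ℕ k ≅ 1 [mod e ] ×
         1 ≤ s ×
         r ≅ s *ℕ ℓ +ℕ sum (applyUpTo (λ i → q ^ (h *ℕ i)) k) [mod q ^ e ∸ 1 ])
    × gcd r (q ∸ 1) ≡ 1 )
theorem1p4 zero e r (p , t , p-prime , 1≤t , 0≡p^t) =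
  contradiction (ℕ.≤-trans (primePower⇒2≤ p-prime 1≤t) (ℕ.≤-reflexive (≡.sym 0≡p^t))) λ ()
theorem1p4 (suc c) e r (p , t , p-prime , 1≤t , q≡p^t) 2≤e 1≤r F card a a≉0 =
    mk⇔ forwards (backwards t p-prime q≡p^t)
  where
  instance
    c≢0 : NonZero c
    c≢0 = >-nonZero (s≤s⁻¹ (ℕ.≤-trans (primePower⇒2≤ p-prime 1≤t) (ℕ.≤-reflexive (≡.sym q≡p^t))))
  open PermutationBinomial F c e r 2≤e 1≤r
    (subst (HasCardinality (CommutativeRing.setoid (fieldRing F))) (Exponents.q^e≡1+N c e) card) a a≉0
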